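{- For every integer $N$, writing $\mathcal{N} := \mathcal{N}(m,n_1,n_2) := N-m-n_1-n_2$, we have $$\sum_{m,n_1,n_2\geq 0} q^{A(n_1,n_2,m)} {3\mathcal{N}\brack m}_q {\mathcal{N} +\left\lfloor \frac{n_1}{2}\right\rfloor \brack \left\lfloor \frac{n_1}{2}\right\rfloor}_{q^6} {\mathcal{N} +\left\lfloor \frac{n_2}{2}\right\rfloor \brack \left\lfloor \frac{n_2}{2}\right\rfloor}_{q^6} = \sum_{j=-N}^N q^{\frac{j(3j-1)}{2}} {N;j;q^3\choose j}_2,$$ where $$A(n_1,n_2,m):= \frac{(2m+n_1+n_2 +1)(2m+n_1+n_2 )}{2} + m(n_1+n_2)+ (n_1+n_2)^2 -n_1.$$
   Context: Here $q$ is a variable and $m,n_1,n_2$ range over non-negative integers. For $n\ge 0$, $(a;q)_n=\prod_{i=0}^{n-1}(1-aq^i)$ and $(q)_n=(q;q)_n$. The $q$-binomial coefficient is, for integers $a,b$, ${a\brack b}_q=\frac{(q)_a}{(q)_{a-b}(q)_b}$ if $a\ge b\ge 0$, and ${a\brack b}_q=0$ otherwise; a subscript $q^6$ means $q$ is replaced by $q^6$. For integers $m,a,b$ the $q$-trinomial coefficient is ${m;b;q\choose a}_2 := \sum_{k\geq 0} q^{k(k+b)} {m\brack k}_q {m-k\brack k+a}_q$, and ${N;j;q^3\choose j}_2$ is this with $m=N$, $b=a=j$ and $q$ replaced by $q^3$. For negative $N$ the sum over $-N\le j\le N$ is empty (both sides are $0$). -}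

module Defs where

open import Algebra.Bundles using (CommutativeRing)
open import Data.Fin.Base using (toℕ)
open import Data.Integer.Base as ℤ using (ℤ; +_; -[1+_]; 0ℤ; ∣_∣)
open import Data.Integer.Properties using (_≤?_; <⇒≱)
open import Data.Nat.Base as ℕ using (ℕ; zero; suc; ⌊_/2⌋)
open import Data.Product.Base using (∃-syntax; _×_; _,_; proj₁; proj₂)
open import Data.Sum.Base using (_⊎_)
open import Function.Base using (_∘_)
open import Level using (_⊔_)
open import Relation.Nullary.Decidable.Core using (yes; no; _×-dec_)
open import Relation.Nullary.Negation.Core using (contradiction)
import Algebra.Definitions as AlgebraicDefinitions
import Algebra.Properties.CommutativeMonoid.Sum as BigOperator
import Algebra.Properties.Semiring.Exp as Exponentiation
import Relation.Binary.Reasoning.Setoid as SetoidReasoning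

-- Both divisions by 2 are exact: in each case the dividend is even.

A : (n₁ n₂ m : ℕ) → ℤ
A n₁ n₂ m =
  ((+ 2 * m′ + n₁′ + n₂′ + + 1) * (+ 2 * m′ + n₁′ + n₂′)) / + 2
    + m′ * (n₁′ + n₂′) + (n₁′ + n₂′) * (n₁′ + n₂′) - n₁′
  where
  open import Data.Integer.Base using (_+_; _*_; _-_; _/_)
  m′ n₁′ n₂′ : ℤ
  m′ = + m
  n₁′ = + n₁
  n₂′ = + n₂

pentagonal : ℤ → ℤ
pentagonal j = (j * (+ 3 * j - + 1)) / + 2
  where open import Data.Integer.Base using (_*_; _-_; _/_)

module QSeries {c ℓ} (R : CommutativeRing c ℓ) where

  open CommutativeRing R
  open AlgebraicDefinitions _≈_ using (Invertible)
  open Exponentiation semiring using (_^_; ^-assocʳ)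
  open BigOperator +-commutativeMonoid using (sum)
  open BigOperator *-commutativeMonoid using () renaming (sum to product)
  open SetoidReasoning setoid

  Unit : Carrier → Set (c ⊔ ℓ)
  Unit = Invertible 1# _*_

  -- Identities between rational functions in a variable q whose denominators
  -- are products of powers of q and of factors 1 - qⁿ (n ≥ 1) live in the
  -- localisation of ℤ[q] at those elements.  That ring is the universal
  -- commutative ring with an element as below, so an identity in the variable
  -- q is an identity valid for every such R and q; ℚ(q) and ℤ((q)), with q the
  -- indeterminate, are instances.

  record Variable : Set (c ⊔ ℓ) where
    field
      q         : Carrier
      q-unit    : Unit q
      1-qⁿ-unit : ∀ n → Unit (1# - q ^ suc n)

  open Variable

  infixl 7 _÷_
  _÷_ : Carrier → ∃[ u ] Unit u → Carrier
  x ÷ (_ , u⁻¹ , _) = x * u⁻¹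

  unit-1 : Unit 1#
  unit-1 = 1# , *-identityˡ 1# , *-identityˡ 1#

  unit-* : ∀ {x y} → Unit x → Unit y → Unit (x * y)
  unit-* {x} {y} (x⁻¹ , x⁻¹x , _) (y⁻¹ , y⁻¹y , _) =
    y⁻¹ * x⁻¹ , left , trans (*-comm _ _) left
    where
    left : (y⁻¹ * x⁻¹) * (x * y) ≈ 1#
    left = begin
      (y⁻¹ * x⁻¹) * (x * y)  ≈⟨ *-assoc _ _ _ ⟩
      y⁻¹ * (x⁻¹ * (x * y))  ≈⟨ *-congˡ (*-assoc _ _ _) ⟨
      y⁻¹ * ((x⁻¹ * x) * y)  ≈⟨ *-congˡ (*-congʳ x⁻¹x) ⟩
      y⁻¹ * (1# * y)         ≈⟨ *-congˡ (*-identityˡ y) ⟩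
      y⁻¹ * y                ≈⟨ y⁻¹y ⟩
      1#                     ∎

  unit-^ : ∀ {x} → Unit x → ∀ n → Unit (x ^ n)
  unit-^ u zero    = unit-1
  unit-^ u (suc n) = unit-* u (unit-^ u n)

  unit-cong : ∀ {x y} → x ≈ y → Unit x → Unit y
  unit-cong x≈y (x⁻¹ , l , r) =
    x⁻¹ , trans (*-congˡ (sym x≈y)) l , trans (*-congʳ (sym x≈y)) r

  infixr 8 _^ᶻ_
  _^ᶻ_ : Variable → ℤ → Carrier
  v ^ᶻ + n      = q v ^ n
  v ^ᶻ -[1+ n ] = proj₁ (q-unit v) ^ suc n

  -- Replacing q by qᵏ, k ≥ 1.

  infixl 9 _↑_
  _↑_ : Variable → (k : ℕ) .{{_ : ℕ.NonZero k}} → Variable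
  v ↑ k@(suc k-1) = record
    { q         = q v ^ k
    ; q-unit    = unit-^ (q-unit v) k
    ; 1-qⁿ-unit = λ n → unit-cong
        (+-congˡ (-‿cong (sym (^-assocʳ (q v) k (suc n)))))
        (1-qⁿ-unit v (n ℕ.+ k-1 ℕ.* suc n))
    }

  infix 6 ∑<_ ∏<_
  ∑<_ ∏<_ : ℕ → (ℕ → Carrier) → Carrier
  (∑< n) f = sum {n} (f ∘ toℕ)
  (∏< n) f = product {n} (f ∘ toℕ)

  ∑[_⋯_] : ℤ → ℤ → (ℤ → Carrier) → Carrier
  ∑[ a ⋯ b ] f with b ℤ.- a
  ... | + l      = (∑< suc l) λ i → f (a ℤ.+ + i)
  ... | -[1+ _ ] = 0#

  -- The family f, indexed by triples of natural numbers, has finite support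
  -- and its sum is s.

  HasSum₃ : (ℕ → ℕ → ℕ → Carrier) → Carrier → Set ℓ
  HasSum₃ f s = ∃[ K ]
    (∀ m n₁ n₂ → K ℕ.≤ m ⊎ K ℕ.≤ n₁ ⊎ K ℕ.≤ n₂ → f m n₁ n₂ ≈ 0#) ×
    ((∑< K) λ m → (∑< K) λ n₁ → (∑< K) λ n₂ → f m n₁ n₂) ≈ s

  poch : (a q : Carrier) (n : ℕ) → Carrier
  poch a q n = (∏< n) λ i → 1# - a * q ^ i

  ⟨_⟩ : Variable → ℕ → Carrier
  ⟨ v ⟩ n = poch (q v) (q v) n

  unit-product : ∀ (f : ℕ → Carrier) → (∀ i → Unit (f i)) →
                 ∀ n → Unit ((∏< n) f)
  unit-product f u zero    = unit-1
  unit-product f u (suc n) =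
    unit-* (u 0) (unit-product (f ∘ suc) (u ∘ suc) n)

  ⟨⟩-unit : ∀ v n → Unit (⟨ v ⟩ n)
  ⟨⟩-unit v = unit-product _ (1-qⁿ-unit v)

  [_,_]_ : ℤ → ℤ → Variable → Carrier
  [ a , b ] v with (0ℤ ≤? b) ×-dec (b ≤? a)
  ... | no  _ = 0#
  ... | yes _ =
    -- a, b and a - b are non-negative here
    ⟨ v ⟩ ∣ a ∣ ÷
      (⟨ v ⟩ ∣ a ℤ.- b ∣ * ⟨ v ⟩ ∣ b ∣ ,
       unit-* (⟨⟩-unit v ∣ a ℤ.- b ∣) (⟨⟩-unit v ∣ b ∣))

  []-zero : ∀ a b v → a ℤ.< b → [ a , b ] v ≈ 0#
  []-zero a b v a<b with (0ℤ ≤? b) ×-dec (b ≤? a)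
  ... | no  _         = refl
  ... | yes (_ , b≤a) = contradiction b≤a (<⇒≱ a<b)

  -- trinomial m b v a is the coefficient written (m; b; q over a)₂.  The sum
  -- over all k ≥ 0 stops at k = ∣ m ∣, since every later term contains the
  -- factor [ m , k ], which is zero by []-zero.

  trinomial : (m b : ℤ) → Variable → (a : ℤ) → Carrier
  trinomial m b v a = (∑< suc ∣ m ∣) λ k →
    v ^ᶻ (+ k ℤ.* (+ k ℤ.+ b)) * [ m , + k ] v * [ m ℤ.- + k , + k ℤ.+ a ] v

  summand : Variable → ℤ → (m n₁ n₂ : ℕ) → Carrier
  summand v N m n₁ n₂ =
    v ^ᶻ A n₁ n₂ m
      * [ + 3 ℤ.* 𝒩 , + m ] v
      * [ 𝒩 ℤ.+ + ⌊ n₁ /2⌋ , + ⌊ n₁ /2⌋ ] (v ↑ 6)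
      * [ 𝒩 ℤ.+ + ⌊ n₂ /2⌋ , + ⌊ n₂ /2⌋ ] (v ↑ 6)
    where
    𝒩 : ℤ
    𝒩 = N ℤ.- + m ℤ.- + n₁ ℤ.- + n₂

  trinomialSum : Variable → ℤ → Carrier
  trinomialSum v N =
    ∑[ ℤ.- N ⋯ N ] λ j → v ^ᶻ pentagonal j * trinomial N j (v ↑ 3) j

{-# OPTIONS --safe #-}
module Submission where

-- Put Q = q³.  For fixed 𝒩 = M and l = m + n₁ + n₂ the exponent is
--   A n₁ n₂ m = 3 C(l,2) + (C(m,2) + 3 m) + n₁ + 2 n₂,
-- so the left side is ∑ₗ Q^C(l,2) [uˡ] H_{N-l}(u), where H_M is a product of
-- three series, one for each summation index.  The q-binomial theorem shows
--   H_M(u) = ∏_{1≤i≤M} (1 + u q³ⁱ) / ∏_{0≤i≤M} (1 - u q³ⁱ⁺¹) (1 - u q³ⁱ⁺²),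
-- and the relation between H_M and H_{M+1} becomes Schur's recurrence
--   s(N+2) = (1 + (q + q²) Qᴺ⁺¹) s(N+1) + Qᴺ⁺¹ (1 - Qᴺ⁺¹) s(N).
-- On the right side the substitution a = k, b = k + j gives (Q;Q)_N times the
-- coefficient of tᴺ in F(t) = (-qt;Q)_∞ (-q²t;Q)_∞ / (t;Q)_∞, and the equation
-- (1 - t) F(t) = (1 + qt) (1 + q²t) F(Qt) yields the same recurrence.

open import Defs
open import Algebra.Bundles using (CommutativeRing)
open import Data.Fin.Base using (toℕ)
open import Data.Fin.Properties using (toℕ<n)
open import Data.Integer.Base as ℤ using (ℤ; +_; -[1+_]; 0ℤ; ∣_∣; +≤+; +<+; -<+)
open import Data.Nat.Base as ℕ using (ℕ; zero; suc; _∸_; z≤n; s≤s; ⌊_/2⌋)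
open import Data.Product.Base using (_,_; _×_; ∃-syntax; proj₁; proj₂)
open import Data.Sum.Base using (_⊎_; inj₁; inj₂)
open import Function.Base using (_∘_; _$_)
open import Relation.Binary.PropositionalEquality as ≡ using (_≡_)
open import Relation.Nullary.Decidable.Core using (yes; no; _×-dec_)
open import Relation.Nullary.Negation.Core using (contradiction)
import Algebra.Properties.CommutativeMonoid.Sum as CommutativeMonoidSum
import Algebra.Properties.Ring as RingProperties
import Algebra.Properties.Semiring.Exp as Exponentiation
import Algebra.Properties.Semiring.Sum as SemiringSum
import Algebra.Solver.Ring.NaturalCoefficients.Default as SemiringSolver
import Data.Integer.DivMod as ℤ-DivMod
import Data.Integer.Properties as ℤₚ
import Data.Integer.Solver as ℤSolver
import Data.Nat.DivMod as ℕ-DivMod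
import Data.Nat.Properties as ℕₚ
import Data.Nat.Solver as ℕSolver
import Relation.Binary.Reasoning.Setoid as SetoidReasoning
open QSeries using (Variable; HasSum₃; summand; trinomialSum)

-- The floors and the top `3 𝒩` are matched to each other. Since 2k and 2k + 1 have the same half,
-- the series in n₁ and n₂ (d = 1, 2) are 1 + q^d u times a series in u². That factor cancels half
-- of the lowest denominator 1 - q^(2d) u², which leaves 1 / ((1 - q^d u) ∏_{1≤i≤M} (1 - q^(d+3i) u)
-- (1 + q^(d+3i) u)). The series in m is ∏_{3≤i≤3M+2} (1 + qⁱ u): its exponents congruent to 1 and 2
-- modulo 3 cancel the factors 1 + q^(d+3i) u, and the multiples of 3 survive. No quotient of power
-- series and no infinite product is ever formed, because the ring is arbitrary. Each product is
-- represented by the relation that adds one factor, and a factor 1 + a u is cancelled because its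
-- constant term is 1. Both recurrences have order two for parallel reasons: on the left, passing
-- from M to M + 1 brings in two denominators; on the right, (1 + qt) (1 + q²t) is quadratic in t.

+[m+n]-+m≡+n : ∀ m n → + (m ℕ.+ n) ℤ.- + m ≡ + n
+[m+n]-+m≡+n m n = ≡.trans (ℤₚ.m-n≡m⊖n (m ℕ.+ n) m)
  (≡.trans (ℤₚ.⊖-≥ (ℕₚ.m≤m+n m n)) (≡.cong +_ (ℕₚ.m+n∸m≡n m n)))

m-[m+n]≡-n : ∀ m n → + m ℤ.- + (m ℕ.+ n) ≡ ℤ.- + n
m-[m+n]≡-n m n = solve 2 (λ m n → m :- (m :+ n) := :- n) ≡.refl (+ m) (+ n)
  where open ℤSolver.+-*-Solver

-- Triangular and pentagonal exponents.

choose₂ : ℕ → ℕ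
choose₂ zero    = 0
choose₂ (suc n) = n ℕ.+ choose₂ n

-- Twice penta d k is k (3 k + 2 d - 3).
penta : ℕ → ℕ → ℕ
penta d zero    = 0
penta d (suc k) = d ℕ.+ 3 ℕ.* k ℕ.+ penta d k

module Exponents where

  open ≡.≡-Reasoning
  open ℕSolver.+-*-Solver

  choose₂-+ : ∀ m n → choose₂ (m ℕ.+ n) ≡ choose₂ m ℕ.+ choose₂ n ℕ.+ m ℕ.* n
  choose₂-+ zero    n = ≡.sym (ℕₚ.+-identityʳ _)
  choose₂-+ (suc m) n = begin
    (m ℕ.+ n) ℕ.+ choose₂ (m ℕ.+ n)
      ≡⟨ ≡.cong (m ℕ.+ n ℕ.+_) (choose₂-+ m n) ⟩
    (m ℕ.+ n) ℕ.+ (choose₂ m ℕ.+ choose₂ n ℕ.+ m ℕ.* n)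
      ≡⟨ solve 4 (λ m n x y → (m :+ n) :+ (x :+ y :+ m :* n)
           := (m :+ x) :+ y :+ (con 1 :+ m) :* n) ≡.refl m n (choose₂ m) (choose₂ n) ⟩
    (m ℕ.+ choose₂ m) ℕ.+ choose₂ n ℕ.+ suc m ℕ.* n ∎

  square : ∀ n → n ℕ.* n ≡ 2 ℕ.* choose₂ n ℕ.+ n
  square zero    = ≡.refl
  square (suc n) = begin
    suc n ℕ.* suc n
      ≡⟨ solve 1 (λ n → (con 1 :+ n) :* (con 1 :+ n) := n :* n :+ (con 2 :* n :+ con 1)) ≡.refl n ⟩
    n ℕ.* n ℕ.+ (2 ℕ.* n ℕ.+ 1)
      ≡⟨ ≡.cong (ℕ._+ (2 ℕ.* n ℕ.+ 1)) (square n) ⟩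
    2 ℕ.* choose₂ n ℕ.+ n ℕ.+ (2 ℕ.* n ℕ.+ 1)
      ≡⟨ solve 2 (λ n x → con 2 :* x :+ n :+ (con 2 :* n :+ con 1)
           := con 2 :* (n :+ x) :+ (con 1 :+ n)) ≡.refl n (choose₂ n) ⟩
    2 ℕ.* (n ℕ.+ choose₂ n) ℕ.+ suc n ∎

  penta-+ : ∀ d m n → penta d (m ℕ.+ n) ≡ penta d m ℕ.+ penta d n ℕ.+ 3 ℕ.* (m ℕ.* n)
  penta-+ d zero    n = ≡.sym (ℕₚ.+-identityʳ _)
  penta-+ d (suc m) n = begin
    d ℕ.+ 3 ℕ.* (m ℕ.+ n) ℕ.+ penta d (m ℕ.+ n)
      ≡⟨ ≡.cong (d ℕ.+ 3 ℕ.* (m ℕ.+ n) ℕ.+_) (penta-+ d m n) ⟩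
    d ℕ.+ 3 ℕ.* (m ℕ.+ n) ℕ.+ (penta d m ℕ.+ penta d n ℕ.+ 3 ℕ.* (m ℕ.* n))
      ≡⟨ solve 5 (λ d m n x y → d :+ con 3 :* (m :+ n) :+ (x :+ y :+ con 3 :* (m :* n))
           := d :+ con 3 :* m :+ x :+ y :+ con 3 :* ((con 1 :+ m) :* n))
           ≡.refl d m n (penta d m) (penta d n) ⟩
    penta d (suc m) ℕ.+ penta d n ℕ.+ 3 ℕ.* (suc m ℕ.* n) ∎

  penta-2 : ∀ k → penta 2 k ≡ penta 1 k ℕ.+ k
  penta-2 zero    = ≡.refl
  penta-2 (suc k) = begin
    2 ℕ.+ 3 ℕ.* k ℕ.+ penta 2 k
      ≡⟨ ≡.cong (2 ℕ.+ 3 ℕ.* k ℕ.+_) (penta-2 k) ⟩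
    2 ℕ.+ 3 ℕ.* k ℕ.+ (penta 1 k ℕ.+ k)
      ≡⟨ solve 2 (λ k x → con 2 :+ con 3 :* k :+ (x :+ k)
           := con 1 :+ con 3 :* k :+ x :+ (con 1 :+ k)) ≡.refl k (penta 1 k) ⟩
    penta 1 (suc k) ℕ.+ suc k ∎

  -- `penta 1 k` and `penta 2 k` are the generalised pentagonal numbers k (3k - 1) / 2 and k (3k +
  -- 1) / 2. Their sum accounts for the 3k² hidden in a cross term 3k (k + e).
  penta-2+1 : ∀ k → penta 2 k ℕ.+ penta 1 k ≡ 3 ℕ.* (k ℕ.* k)
  penta-2+1 zero    = ≡.refl
  penta-2+1 (suc k) = begin
    2 ℕ.+ 3 ℕ.* k ℕ.+ penta 2 k ℕ.+ (1 ℕ.+ 3 ℕ.* k ℕ.+ penta 1 k)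
      ≡⟨ solve 3 (λ k x y → con 2 :+ con 3 :* k :+ x :+ (con 1 :+ con 3 :* k :+ y)
           := x :+ y :+ (con 3 :+ con 6 :* k)) ≡.refl k (penta 2 k) (penta 1 k) ⟩
    penta 2 k ℕ.+ penta 1 k ℕ.+ (3 ℕ.+ 6 ℕ.* k)
      ≡⟨ ≡.cong (ℕ._+ (3 ℕ.+ 6 ℕ.* k)) (penta-2+1 k) ⟩
    3 ℕ.* (k ℕ.* k) ℕ.+ (3 ℕ.+ 6 ℕ.* k)
      ≡⟨ solve 1 (λ k → con 3 :* (k :* k) :+ (con 3 :+ con 6 :* k)
           := con 3 :* ((con 1 :+ k) :* (con 1 :+ k))) ≡.refl k ⟩
    3 ℕ.* (suc k ℕ.* suc k) ∎

  half : ∀ k → (+ (k ℕ.* 2)) ℤ./ + 2 ≡ + k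
  half k = ≡.trans (ℤ-DivMod.div-pos-is-/ℕ (+ (k ℕ.* 2)) 2) (≡.cong +_ (ℕ-DivMod.m*n/n≡m k 2))

  m+n-n≡m : ∀ m n → + (m ℕ.+ n) ℤ.- + n ≡ + m
  m+n-n≡m m n = ≡.trans (≡.cong (λ k → + k ℤ.- + n) (ℕₚ.+-comm m n)) (+[m+n]-+m≡+n n m)

  -- The halving and the subtraction of n₁ are carried out on exact natural multiples, so the
  -- exponent becomes a natural number split by index. The form `1 ℕ.* n₁` is kept because it is the
  -- case d = 1 of the exponent in `X d`.
  A-value : ∀ n₁ n₂ m → A n₁ n₂ m ≡ + (3 ℕ.* choose₂ (m ℕ.+ (n₁ ℕ.+ n₂)) ℕ.+
                                       ((choose₂ m ℕ.+ 3 ℕ.* m) ℕ.+ (1 ℕ.* n₁ ℕ.+ 2 ℕ.* n₂)))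
  A-value n₁ n₂ m = begin
    A n₁ n₂ m
      ≡⟨ ≡.cong₂ (λ x y → ((x ℤ.+ + n₁ ℤ.+ + n₂ ℤ.+ + 1) ℤ.* (x ℤ.+ + n₁ ℤ.+ + n₂)) ℤ./ + 2
                            ℤ.+ y ℤ.+ + n ℤ.* + n ℤ.- + n₁) (≡.sym (ℤₚ.pos-* 2 m)) (≡.sym (ℤₚ.pos-* m n)) ⟩
    (+ (s ℕ.+ 1) ℤ.* + s) ℤ./ + 2 ℤ.+ + (m ℕ.* n) ℤ.+ + n ℤ.* + n ℤ.- + n₁
      ≡⟨ ≡.cong₂ (λ x y → x ℤ./ + 2 ℤ.+ + (m ℕ.* n) ℤ.+ y ℤ.- + n₁) twice (≡.sym (ℤₚ.pos-* n n)) ⟩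
    + (choose₂ (suc s) ℕ.* 2) ℤ./ + 2 ℤ.+ + (m ℕ.* n) ℤ.+ + (n ℕ.* n) ℤ.- + n₁
      ≡⟨ ≡.cong (λ x → x ℤ.+ + (m ℕ.* n) ℤ.+ + (n ℕ.* n) ℤ.- + n₁) (half (choose₂ (suc s))) ⟩
    + (choose₂ (suc s) ℕ.+ m ℕ.* n ℕ.+ n ℕ.* n) ℤ.- + n₁
      ≡⟨ ≡.cong (λ x → + x ℤ.- + n₁) value ⟩
    + (e ℕ.+ n₁) ℤ.- + n₁
      ≡⟨ m+n-n≡m e n₁ ⟩
    + e ∎
    where
    n = n₁ ℕ.+ n₂
    s = 2 ℕ.* m ℕ.+ n₁ ℕ.+ n₂
    e = 3 ℕ.* choose₂ (m ℕ.+ n) ℕ.+ ((choose₂ m ℕ.+ 3 ℕ.* m) ℕ.+ (1 ℕ.* n₁ ℕ.+ 2 ℕ.* n₂))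
    twice : + (s ℕ.+ 1) ℤ.* + s ≡ + (choose₂ (suc s) ℕ.* 2)
    twice = ≡.trans (≡.sym (ℤₚ.pos-* (s ℕ.+ 1) s)) (≡.cong +_ (begin
      (s ℕ.+ 1) ℕ.* s
        ≡⟨ solve 1 (λ s → (s :+ con 1) :* s := s :* s :+ s) ≡.refl s ⟩
      s ℕ.* s ℕ.+ s
        ≡⟨ ≡.cong (ℕ._+ s) (square s) ⟩
      2 ℕ.* choose₂ s ℕ.+ s ℕ.+ s
        ≡⟨ solve 2 (λ s x → con 2 :* x :+ s :+ s := (s :+ x) :* con 2) ≡.refl s (choose₂ s) ⟩
      choose₂ (suc s) ℕ.* 2 ∎))
    choose₂-s : choose₂ s ≡ choose₂ m ℕ.+ choose₂ m ℕ.+ m ℕ.* m ℕ.+ choose₂ n ℕ.+ (m ℕ.+ m) ℕ.* n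
    choose₂-s = begin
      choose₂ s
        ≡⟨ ≡.cong choose₂ (solve 3 (λ m n₁ n₂ → con 2 :* m :+ n₁ :+ n₂ := m :+ m :+ (n₁ :+ n₂)) ≡.refl m n₁ n₂) ⟩
      choose₂ (m ℕ.+ m ℕ.+ n)
        ≡⟨ choose₂-+ (m ℕ.+ m) n ⟩
      choose₂ (m ℕ.+ m) ℕ.+ choose₂ n ℕ.+ (m ℕ.+ m) ℕ.* n
        ≡⟨ ≡.cong (λ x → x ℕ.+ choose₂ n ℕ.+ (m ℕ.+ m) ℕ.* n) (choose₂-+ m m) ⟩
      choose₂ m ℕ.+ choose₂ m ℕ.+ m ℕ.* m ℕ.+ choose₂ n ℕ.+ (m ℕ.+ m) ℕ.* n ∎
    value : choose₂ (suc s) ℕ.+ m ℕ.* n ℕ.+ n ℕ.* n ≡ e ℕ.+ n₁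
    value = begin
      s ℕ.+ choose₂ s ℕ.+ m ℕ.* n ℕ.+ n ℕ.* n
        ≡⟨ ≡.cong (λ x → s ℕ.+ x ℕ.+ m ℕ.* n ℕ.+ n ℕ.* n) choose₂-s ⟩
      s ℕ.+ (choose₂ m ℕ.+ choose₂ m ℕ.+ m ℕ.* m ℕ.+ choose₂ n ℕ.+ (m ℕ.+ m) ℕ.* n)
        ℕ.+ m ℕ.* n ℕ.+ n ℕ.* n
        ≡⟨ ≡.cong₂ (λ x y → s ℕ.+ (choose₂ m ℕ.+ choose₂ m ℕ.+ x ℕ.+ choose₂ n ℕ.+ (m ℕ.+ m) ℕ.* n)
                            ℕ.+ m ℕ.* n ℕ.+ y) (square m) (square n) ⟩
      s ℕ.+ (choose₂ m ℕ.+ choose₂ m ℕ.+ (2 ℕ.* choose₂ m ℕ.+ m) ℕ.+ choose₂ n ℕ.+ (m ℕ.+ m) ℕ.* n)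
        ℕ.+ m ℕ.* n ℕ.+ (2 ℕ.* choose₂ n ℕ.+ n)
        ≡⟨ solve 5 (λ m n₁ n₂ x y →
             (con 2 :* m :+ n₁ :+ n₂)
               :+ (x :+ x :+ (con 2 :* x :+ m) :+ y :+ (m :+ m) :* (n₁ :+ n₂))
               :+ m :* (n₁ :+ n₂) :+ (con 2 :* y :+ (n₁ :+ n₂))
             := con 3 :* (x :+ y :+ m :* (n₁ :+ n₂))
                  :+ ((x :+ con 3 :* m) :+ (con 1 :* n₁ :+ con 2 :* n₂)) :+ n₁)
             ≡.refl m n₁ n₂ (choose₂ m) (choose₂ n) ⟩
      3 ℕ.* (choose₂ m ℕ.+ choose₂ n ℕ.+ m ℕ.* n)
        ℕ.+ ((choose₂ m ℕ.+ 3 ℕ.* m) ℕ.+ (1 ℕ.* n₁ ℕ.+ 2 ℕ.* n₂)) ℕ.+ n₁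
        ≡⟨ ≡.cong (λ x → 3 ℕ.* x ℕ.+ ((choose₂ m ℕ.+ 3 ℕ.* m) ℕ.+ (1 ℕ.* n₁ ℕ.+ 2 ℕ.* n₂)) ℕ.+ n₁)
             (choose₂-+ m n) ⟨
      e ℕ.+ n₁ ∎

  pentagonal-pos : ∀ k → pentagonal (+ k) ≡ + penta 1 k
  pentagonal-pos k = ≡.trans (≡.cong (ℤ._/ + 2) (begin
    + k ℤ.* (+ 3 ℤ.* + k ℤ.- + 1)
      ≡⟨ ℤS.solve 1 (λ k → k ℤS.:* (ℤS.con (+ 3) ℤS.:* k ℤS.:- ℤS.con (+ 1))
           ℤS.:= ℤS.con (+ 3) ℤS.:* (k ℤS.:* k) ℤS.:- k) ≡.refl (+ k) ⟩
    + 3 ℤ.* (+ k ℤ.* + k) ℤ.- + k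
      ≡⟨ ≡.cong (ℤ._- + k) (≡.trans (ℤₚ.pos-* 3 (k ℕ.* k)) (≡.cong (+ 3 ℤ.*_) (ℤₚ.pos-* k k))) ⟨
    + (3 ℕ.* (k ℕ.* k)) ℤ.- + k
      ≡⟨ ≡.cong (λ x → + x ℤ.- + k) (begin
        3 ℕ.* (k ℕ.* k)                ≡⟨ penta-2+1 k ⟨
        penta 2 k ℕ.+ penta 1 k        ≡⟨ ≡.cong (ℕ._+ penta 1 k) (penta-2 k) ⟩
        penta 1 k ℕ.+ k ℕ.+ penta 1 k  ≡⟨ solve 2 (λ x k → x :+ k :+ x := x :* con 2 :+ k) ≡.refl (penta 1 k) k ⟩
        penta 1 k ℕ.* 2 ℕ.+ k          ∎) ⟩
    + (penta 1 k ℕ.* 2 ℕ.+ k) ℤ.- + k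
      ≡⟨ m+n-n≡m (penta 1 k ℕ.* 2) k ⟩
    + (penta 1 k ℕ.* 2) ∎)) (half (penta 1 k))
    where module ℤS = ℤSolver.+-*-Solver

  pentagonal-neg : ∀ k → pentagonal (ℤ.- + k) ≡ + penta 2 k
  pentagonal-neg k = ≡.trans (≡.cong (ℤ._/ + 2) (begin
    ℤ.- + k ℤ.* (+ 3 ℤ.* (ℤ.- + k) ℤ.- + 1)
      ≡⟨ ℤS.solve 1 (λ k → ℤS.:- k ℤS.:* (ℤS.con (+ 3) ℤS.:* (ℤS.:- k) ℤS.:- ℤS.con (+ 1))
           ℤS.:= ℤS.con (+ 3) ℤS.:* (k ℤS.:* k) ℤS.:+ k) ≡.refl (+ k) ⟩
    + 3 ℤ.* (+ k ℤ.* + k) ℤ.+ + k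
      ≡⟨ ≡.cong (ℤ._+ + k) (≡.trans (ℤₚ.pos-* 3 (k ℕ.* k)) (≡.cong (+ 3 ℤ.*_) (ℤₚ.pos-* k k))) ⟨
    + (3 ℕ.* (k ℕ.* k) ℕ.+ k)
      ≡⟨ ≡.cong +_ (begin
        3 ℕ.* (k ℕ.* k) ℕ.+ k              ≡⟨ ≡.cong (ℕ._+ k) (penta-2+1 k) ⟨
        penta 2 k ℕ.+ penta 1 k ℕ.+ k      ≡⟨ ℕₚ.+-assoc (penta 2 k) _ _ ⟩
        penta 2 k ℕ.+ (penta 1 k ℕ.+ k)    ≡⟨ ≡.cong (penta 2 k ℕ.+_) (penta-2 k) ⟨
        penta 2 k ℕ.+ penta 2 k            ≡⟨ solve 1 (λ x → x :+ x := x :* con 2) ≡.refl (penta 2 k) ⟩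
        penta 2 k ℕ.* 2                    ∎) ⟩
    + (penta 2 k ℕ.* 2) ∎)) (half (penta 2 k))
    where module ℤS = ℤSolver.+-*-Solver

  -- With j = b - k, the quadratic part of j (3j - 1) / 2 contains -3kb, which the factor Q^(k (k +
  -- j)) = Q^(kb) of the trinomial compensates; k and b then decouple. The witness is `penta 1 e`
  -- for j = e and `penta 2 e` for j = - e, a natural number in both cases, so no inverse power of q
  -- remains.
  pentagonal-difference : ∀ k b → ∃[ p ] pentagonal (+ b ℤ.- + k) ≡ + p
                        × p ℕ.+ 3 ℕ.* (k ℕ.* b) ≡ penta 2 k ℕ.+ penta 1 b
  pentagonal-difference k b with ℕₚ.≤-total k b
  ... | inj₁ k≤b with e , ≡.refl ← ℕₚ.m≤n⇒∃[o]m+o≡n k≤b = penta 1 e ,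
    ≡.trans (≡.cong pentagonal (+[m+n]-+m≡+n k e)) (pentagonal-pos e) , (begin
    penta 1 e ℕ.+ 3 ℕ.* (k ℕ.* (k ℕ.+ e))
      ≡⟨ solve 3 (λ x k e → x :+ con 3 :* (k :* (k :+ e))
           := con 3 :* (k :* k) :+ (x :+ con 3 :* (k :* e))) ≡.refl (penta 1 e) k e ⟩
    3 ℕ.* (k ℕ.* k) ℕ.+ (penta 1 e ℕ.+ 3 ℕ.* (k ℕ.* e))
      ≡⟨ ≡.cong (ℕ._+ (penta 1 e ℕ.+ 3 ℕ.* (k ℕ.* e))) (penta-2+1 k) ⟨
    penta 2 k ℕ.+ penta 1 k ℕ.+ (penta 1 e ℕ.+ 3 ℕ.* (k ℕ.* e))
      ≡⟨ solve 4 (λ x y z w → x :+ y :+ (z :+ w) := x :+ (y :+ z :+ w)) ≡.refl (penta 2 k) (penta 1 k) (penta 1 e) (3 ℕ.* (k ℕ.* e)) ⟩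
    penta 2 k ℕ.+ (penta 1 k ℕ.+ penta 1 e ℕ.+ 3 ℕ.* (k ℕ.* e))
      ≡⟨ ≡.cong (penta 2 k ℕ.+_) (penta-+ 1 k e) ⟨
    penta 2 k ℕ.+ penta 1 (k ℕ.+ e) ∎)
  ... | inj₂ b≤k with e , ≡.refl ← ℕₚ.m≤n⇒∃[o]m+o≡n b≤k = penta 2 e ,
    ≡.trans (≡.cong pentagonal (m-[m+n]≡-n b e)) (pentagonal-neg e) , (begin
    penta 2 e ℕ.+ 3 ℕ.* ((b ℕ.+ e) ℕ.* b)
      ≡⟨ solve 3 (λ x b e → x :+ con 3 :* ((b :+ e) :* b)
           := con 3 :* (b :* b) :+ (x :+ con 3 :* (b :* e))) ≡.refl (penta 2 e) b e ⟩
    3 ℕ.* (b ℕ.* b) ℕ.+ (penta 2 e ℕ.+ 3 ℕ.* (b ℕ.* e))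
      ≡⟨ ≡.cong (ℕ._+ (penta 2 e ℕ.+ 3 ℕ.* (b ℕ.* e))) (penta-2+1 b) ⟨
    penta 2 b ℕ.+ penta 1 b ℕ.+ (penta 2 e ℕ.+ 3 ℕ.* (b ℕ.* e))
      ≡⟨ solve 4 (λ x y z w → x :+ y :+ (z :+ w) := (x :+ z :+ w) :+ y) ≡.refl (penta 2 b) (penta 1 b) (penta 2 e) (3 ℕ.* (b ℕ.* e)) ⟩
    (penta 2 b ℕ.+ penta 2 e ℕ.+ 3 ℕ.* (b ℕ.* e)) ℕ.+ penta 1 b
      ≡⟨ ≡.cong (ℕ._+ penta 1 b) (penta-+ 2 b e) ⟨
    penta 2 (b ℕ.+ e) ℕ.+ penta 1 b ∎)

-- Finite sums and antidiagonal sums.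

module Series {c ℓ} (R : CommutativeRing c ℓ) where

  open CommutativeRing R hiding (zero)
  open QSeries R using (∑<_)
  open RingProperties ring using (-‿distribˡ-*; +-cancelʳ)
  open CommutativeMonoidSum +-commutativeMonoid using (sum-cong-≋; sum-replicate-zero; ∑-distrib-+; ∑-comm)
  open SemiringSum semiring using (*-distribˡ-sum)
  open Exponentiation semiring using (_^_; ^-homo-*)
  open SetoidReasoning setoid
  open SemiringSolver commutativeSemiring using (solve; _:=_; _:+_; _:*_; con)

  +-cancel-neg : ∀ x y → x + - y + y ≈ x
  +-cancel-neg x y = trans (+-assoc x (- y) y) (trans (+-congˡ (-‿inverseˡ y)) (+-identityʳ x))

  ∑-cong : ∀ n {f g : ℕ → Carrier} → (∀ i → i ℕ.< n → f i ≈ g i) →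
           (∑< n) f ≈ (∑< n) g
  ∑-cong n f≈g = sum-cong-≋ λ i → f≈g (toℕ i) (toℕ<n i)

  ∑-zero : ∀ n {f : ℕ → Carrier} → (∀ i → i ℕ.< n → f i ≈ 0#) → (∑< n) f ≈ 0#
  ∑-zero n f≈0 = trans (∑-cong n f≈0) (sum-replicate-zero n)

  ∑-truncate : ∀ n r {f : ℕ → Carrier} → (∀ i → n ℕ.≤ i → f i ≈ 0#) →
               (∑< (n ℕ.+ r)) f ≈ (∑< n) f
  ∑-truncate zero    r f≈0 = ∑-zero r λ i _ → f≈0 i z≤n
  ∑-truncate (suc n) r f≈0 =
    +-congˡ (∑-truncate n r λ i n≤i → f≈0 (suc i) (s≤s n≤i))

  ∑-drop : ∀ s n {f : ℕ → Carrier} → (∀ i → i ℕ.< s → f i ≈ 0#) →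
           (∑< (s ℕ.+ n)) f ≈ (∑< n) (λ i → f (s ℕ.+ i))
  ∑-drop zero    n f≈0 = refl
  ∑-drop (suc s) n {f} f≈0 = begin
    f 0 + (∑< (s ℕ.+ n)) (f ∘ suc)  ≈⟨ +-congʳ (f≈0 0 (s≤s z≤n)) ⟩
    0# + (∑< (s ℕ.+ n)) (f ∘ suc)   ≈⟨ +-identityˡ _ ⟩
    (∑< (s ℕ.+ n)) (f ∘ suc)        ≈⟨ ∑-drop s n (λ i i<s → f≈0 (suc i) (s≤s i<s)) ⟩
    (∑< n) (λ i → f (suc s ℕ.+ i))  ∎

  ∑-*ˡ : ∀ n x f → x * (∑< n) f ≈ (∑< n) (λ i → x * f i)
  ∑-*ˡ n x f = *-distribˡ-sum {n} x (f ∘ toℕ)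

  ∑-swap : ∀ m n (f : ℕ → ℕ → Carrier) → (∑< m) (λ i → (∑< n) (f i)) ≈ (∑< n) (λ k → (∑< m) λ i → f i k)
  ∑-swap m n f = ∑-comm {m} {n} λ i k → f (toℕ i) (toℕ k)

  -- Both indices are handed over as arguments, so identities on the diagonal use `i + j ≡ n`
  -- instead of truncated subtraction; `antidiagonal-∑` is the passage to an ordinary sum.
  antidiagonal : (ℕ → ℕ → Carrier) → ℕ → Carrier
  antidiagonal P zero    = P 0 0
  antidiagonal P (suc n) = P 0 (suc n) + antidiagonal (P ∘ suc) n

  antidiagonal-cong : ∀ n {P P′} → (∀ i j → i ℕ.+ j ≡ n → P i j ≈ P′ i j) →
                      antidiagonal P n ≈ antidiagonal P′ n
  antidiagonal-cong zero    eq = eq 0 0 ≡.refl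
  antidiagonal-cong (suc n) eq =
    +-cong (eq 0 (suc n) ≡.refl)
           (antidiagonal-cong n λ i j i+j≡n → eq (suc i) j (≡.cong suc i+j≡n))

  antidiagonal-+ : ∀ n {P P′} → antidiagonal (λ i j → P i j + P′ i j) n
                              ≈ antidiagonal P n + antidiagonal P′ n
  antidiagonal-+ zero = refl
  antidiagonal-+ (suc n) {P} {P′} = begin
    _ ≈⟨ +-congˡ (antidiagonal-+ n) ⟩
    _ ≈⟨ solve 4 (λ a b c d → (a :+ b) :+ (c :+ d) := (a :+ c) :+ (b :+ d)) refl _ _ _ _ ⟩
    _ ∎

  antidiagonal-* : ∀ n x {P} → antidiagonal (λ i j → x * P i j) n
                             ≈ x * antidiagonal P n
  antidiagonal-* zero    x = refl
  antidiagonal-* (suc n) x = trans (+-congˡ (antidiagonal-* n x)) (sym (distribˡ x _ _))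

  antidiagonal-zero : ∀ n {P} → (∀ i j → i ℕ.+ j ≡ n → P i j ≈ 0#) →
                      antidiagonal P n ≈ 0#
  antidiagonal-zero n P≈0 = trans
    (antidiagonal-cong n λ i j i+j≡n → trans (P≈0 i j i+j≡n) (sym (zeroˡ 0#)))
    (trans (antidiagonal-* n 0#) (zeroˡ _))

  antidiagonal-last : ∀ n P → antidiagonal P (suc n)
                    ≈ antidiagonal (λ i j → P i (suc j)) n + P (suc n) 0
  antidiagonal-last zero    P = refl
  antidiagonal-last (suc n) P =
    trans (+-congˡ (antidiagonal-last n (P ∘ suc))) (sym (+-assoc _ _ _))

  antidiagonal-∑ : ∀ n P → antidiagonal P n ≈ (∑< suc n) (λ i → P i (n ∸ i))
  antidiagonal-∑ zero    P = sym (+-identityʳ _)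
  antidiagonal-∑ (suc n) P = +-congˡ (antidiagonal-∑ n (P ∘ suc))

  -- The support lies in the triangle i + j < n, so a rectangle at least that wide contains all of
  -- it. The width `J` is separate from `n` because removing a row shrinks the triangle but not the
  -- rows.
  ∑-square : ∀ n J P → n ℕ.≤ J → (∀ i j → n ℕ.≤ i ℕ.+ j → P i j ≈ 0#) →
             (∑< n) (λ i → (∑< J) (P i)) ≈ (∑< n) (antidiagonal P)
  ∑-square zero    J P n≤J P≈0 = refl
  ∑-square (suc n) J P n≤J P≈0 = begin
    (∑< J) (P 0) + (∑< n) (λ i → (∑< J) (P (suc i)))
      ≈⟨ +-congʳ row ⟩
    (∑< suc n) (P 0) + (∑< n) (λ i → (∑< J) (P (suc i)))
      ≈⟨ +-congˡ (∑-square n J (P ∘ suc) (ℕₚ.<⇒≤ n≤J) λ i j n≤ → P≈0 (suc i) j (s≤s n≤)) ⟩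
    (P 0 0 + (∑< n) (P 0 ∘ suc)) + (∑< n) (antidiagonal (P ∘ suc))
      ≈⟨ +-assoc _ _ _ ⟩
    P 0 0 + ((∑< n) (P 0 ∘ suc) + (∑< n) (antidiagonal (P ∘ suc)))
      ≈⟨ +-congˡ (∑-distrib-+ {n} (P 0 ∘ suc ∘ toℕ) (antidiagonal (P ∘ suc) ∘ toℕ)) ⟨
    (∑< suc n) (antidiagonal P) ∎
    where
    row : (∑< J) (P 0) ≈ (∑< suc n) (P 0)
    row with r , ≡.refl ← ℕₚ.m≤n⇒∃[o]m+o≡n n≤J = ∑-truncate (suc n) r (P≈0 0)

  -- Formal power series as coefficient sequences.

  Seq : Set c
  Seq = ℕ → Carrier

  infix 4 _≐_
  _≐_ : Seq → Seq → Set ℓ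
  f ≐ g = ∀ n → f n ≈ g n

  infixr 5 1+_·_
  infixr 6 _⋆_

  -- A sequence stands for its generating function in a variable t; in this
  -- reading 1+ a · f is (1 + a t) f, _⋆_ is the product and dilate p f is
  -- f (p t).

  1+_·_ : Carrier → Seq → Seq
  (1+ a · f) zero    = f 0
  (1+ a · f) (suc n) = f (suc n) + a * f n

  _⋆_ : Seq → Seq → Seq
  f ⋆ g = antidiagonal λ i j → f i * g j

  dilate : Carrier → Seq → Seq
  dilate p f n = p ^ n * f n

  δ : Seq
  δ zero    = 1#
  δ (suc _) = 0#

  1+-cong : ∀ {a b f g} → a ≈ b → f ≐ g → 1+ a · f ≐ 1+ b · g
  1+-cong a≈b f≐g zero    = f≐g 0
  1+-cong a≈b f≐g (suc n) = +-cong (f≐g (suc n)) (*-cong a≈b (f≐g n))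

  1+-congˡ : ∀ {a f g} → f ≐ g → 1+ a · f ≐ 1+ a · g
  1+-congˡ = 1+-cong refl

  1+-comm : ∀ a b f → 1+ a · 1+ b · f ≐ 1+ b · 1+ a · f
  1+-comm a b f zero    = refl
  1+-comm a b f (suc zero) =
    solve 4 (λ a b f₀ f₁ → (f₁ :+ b :* f₀) :+ a :* f₀ := (f₁ :+ a :* f₀) :+ b :* f₀)
      refl a b (f 0) (f 1)
  1+-comm a b f (suc (suc n)) =
    solve 5 (λ a b f₀ f₁ f₂ → (f₂ :+ b :* f₁) :+ a :* (f₁ :+ b :* f₀)
                           := (f₂ :+ a :* f₁) :+ b :* (f₁ :+ a :* f₀))
      refl a b (f n) (f (suc n)) (f (suc (suc n)))

  -- The constant term 1 makes 1 + a t a non-zero-divisor over every ring: the coefficients agree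
  -- one after another. This replaces division by power series.
  1+-cancel : ∀ a {f g} → 1+ a · f ≐ 1+ a · g → f ≐ g
  1+-cancel a eq zero    = eq 0
  1+-cancel a {f} {g} eq (suc n) = +-cancelʳ (a * f n) _ _ $ begin
    f (suc n) + a * f n  ≈⟨ eq (suc n) ⟩
    g (suc n) + a * g n  ≈⟨ +-congˡ (*-congˡ (1+-cancel a eq n)) ⟨
    g (suc n) + a * f n  ∎

  -- The hypotheses say (1 - a² t²) f = g coefficientwise. A step of two is the form in which a
  -- recurrence in ⌊n/2⌋ appears.
  1+-square : ∀ a {f g} → f 0 ≈ g 0 → f 1 ≈ g 1 →
              (∀ n → f (suc (suc n)) ≈ g (suc (suc n)) + a * a * f n) →
              1+ (- a) · 1+ a · f ≐ g
  1+-square a f₀≈g₀ f₁≈g₁ step zero = f₀≈g₀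
  1+-square a {f} {g} f₀≈g₀ f₁≈g₁ step (suc zero) = begin
    f 1 + a * f 0 + - a * f 0      ≈⟨ +-congˡ (-‿distribˡ-* a (f 0)) ⟨
    f 1 + a * f 0 + - (a * f 0)    ≈⟨ +-assoc _ _ _ ⟩
    f 1 + (a * f 0 + - (a * f 0))  ≈⟨ +-cong f₁≈g₁ (-‿inverseʳ _) ⟩
    g 1 + 0#                       ≈⟨ +-identityʳ _ ⟩
    g 1                            ∎
  1+-square a {f} {g} f₀≈g₀ f₁≈g₁ step (suc (suc n)) = begin
    f (suc (suc n)) + a * f (suc n) + - a * (f (suc n) + a * f n)
      ≈⟨ +-congʳ (+-congʳ (step n)) ⟩
    g (suc (suc n)) + a * a * f n + a * f (suc n) + - a * (f (suc n) + a * f n)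
      ≈⟨ solve 5 (λ g a a⁻ f₁ f₀ →
           g :+ a :* a :* f₀ :+ a :* f₁ :+ a⁻ :* (f₁ :+ a :* f₀)
             := g :+ (a :+ a⁻) :* (f₁ :+ a :* f₀))
           refl (g (suc (suc n))) a (- a) (f (suc n)) (f n) ⟩
    g (suc (suc n)) + (a + - a) * (f (suc n) + a * f n)
      ≈⟨ +-congˡ (trans (*-congʳ (-‿inverseʳ a)) (zeroˡ _)) ⟩
    g (suc (suc n)) + 0#
      ≈⟨ +-identityʳ _ ⟩
    g (suc (suc n)) ∎

  geometric : ∀ a {f} → f 0 ≈ 1# → (∀ n → f (suc n) ≈ a * f n) → 1+ (- a) · f ≐ δ
  geometric a f₀≈1 step zero = f₀≈1
  geometric a {f} f₀≈1 step (suc n) = begin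
    f (suc n) + - a * f n     ≈⟨ +-cong (step n) (sym (-‿distribˡ-* a (f n))) ⟩
    a * f n + - (a * f n)     ≈⟨ -‿inverseʳ _ ⟩
    0#                        ∎

  ⋆-cong : ∀ {f f′ g g′} → f ≐ f′ → g ≐ g′ → f ⋆ g ≐ f′ ⋆ g′
  ⋆-cong f≐f′ g≐g′ n = antidiagonal-cong n λ i j _ → *-cong (f≐f′ i) (g≐g′ j)

  ⋆-identityˡ : ∀ f → δ ⋆ f ≐ f
  ⋆-identityˡ f zero    = *-identityˡ _
  ⋆-identityˡ f (suc n) = begin
    1# * f (suc n) + antidiagonal (λ i j → 0# * f j) n
      ≈⟨ +-cong (*-identityˡ _) (antidiagonal-* n 0#) ⟩
    f (suc n) + 0# * antidiagonal (λ i j → f j) n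
      ≈⟨ trans (+-congˡ (zeroˡ _)) (+-identityʳ _) ⟩
    f (suc n) ∎

  1+-⋆ˡ : ∀ a f g → (1+ a · f) ⋆ g ≐ 1+ a · f ⋆ g
  1+-⋆ˡ a f g zero    = refl
  1+-⋆ˡ a f g (suc n) = begin
    f 0 * g (suc n) + antidiagonal (λ i j → (f (suc i) + a * f i) * g j) n
      ≈⟨ +-congˡ (antidiagonal-cong n λ i j _ → solve 4
           (λ x a y z → (x :+ a :* y) :* z := x :* z :+ a :* (y :* z)) refl _ _ _ _) ⟩
    f 0 * g (suc n) + antidiagonal (λ i j → f (suc i) * g j + a * (f i * g j)) n
      ≈⟨ +-congˡ (trans (antidiagonal-+ n) (+-congˡ (antidiagonal-* n a))) ⟩
    f 0 * g (suc n) + (((f ∘ suc) ⋆ g) n + a * (f ⋆ g) n)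
      ≈⟨ +-assoc _ _ _ ⟨
    (f ⋆ g) (suc n) + a * (f ⋆ g) n ∎

  1+-⋆ʳ : ∀ a f g → f ⋆ (1+ a · g) ≐ 1+ a · f ⋆ g
  1+-⋆ʳ a f g zero    = refl
  1+-⋆ʳ a f g (suc n) = begin
    (f ⋆ (1+ a · g)) (suc n)
      ≈⟨ antidiagonal-last n (λ i j → f i * (1+ a · g) j) ⟩
    antidiagonal (λ i j → f i * (g (suc j) + a * g j)) n + f (suc n) * g 0
      ≈⟨ +-congʳ (antidiagonal-cong n λ i j _ → solve 4
           (λ x a y z → x :* (y :+ a :* z) := x :* y :+ a :* (x :* z)) refl _ _ _ _) ⟩
    antidiagonal (λ i j → f i * g (suc j) + a * (f i * g j)) n + f (suc n) * g 0
      ≈⟨ +-congʳ (trans (antidiagonal-+ n) (+-congˡ (antidiagonal-* n a))) ⟩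
    antidiagonal (λ i j → f i * g (suc j)) n + a * (f ⋆ g) n + f (suc n) * g 0
      ≈⟨ solve 3 (λ x y z → x :+ y :+ z := x :+ z :+ y) refl _ _ _ ⟩
    antidiagonal (λ i j → f i * g (suc j)) n + f (suc n) * g 0 + a * (f ⋆ g) n
      ≈⟨ +-congʳ (antidiagonal-last n (λ i j → f i * g j)) ⟨
    (f ⋆ g) (suc n) + a * (f ⋆ g) n ∎

  dilate-⋆ : ∀ p f g → dilate p f ⋆ dilate p g ≐ dilate p (f ⋆ g)
  dilate-⋆ p f g n = trans (antidiagonal-cong n term) (antidiagonal-* n (p ^ n))
    where
    term : ∀ i j → i ℕ.+ j ≡ n → p ^ i * f i * (p ^ j * g j) ≈ p ^ n * (f i * g j)
    term i j ≡.refl = begin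
      p ^ i * f i * (p ^ j * g j)   ≈⟨ solve 4 (λ a x b y → a :* x :* (b :* y) := a :* b :* (x :* y)) refl _ _ _ _ ⟩
      p ^ i * p ^ j * (f i * g j)   ≈⟨ *-congʳ (^-homo-* p i j) ⟨
      p ^ (i ℕ.+ j) * (f i * g j)   ∎

-- q-factorials and the q-Pascal rule.

module QBinomial {c ℓ} (R : CommutativeRing c ℓ) where

  open CommutativeRing R hiding (zero)
  open QSeries R hiding (Variable; HasSum₃; summand; trinomialSum)
  open Variable using (q)
  open Series R
  open RingProperties ring using (-‿distribʳ-*)
  open Exponentiation semiring using (_^_; ^-homo-*; ^-congʳ)
  open SetoidReasoning setoid
  open SemiringSolver commutativeSemiring using (solve; _:=_; _:+_; _:*_; con)

  ∏-last : ∀ n f → (∏< suc n) f ≈ (∏< n) f * f n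
  ∏-last zero    f = *-comm (f 0) 1#
  ∏-last (suc n) f = trans (*-congˡ (∏-last n (f ∘ suc))) (sym (*-assoc _ _ _))

  ⟨_⟩⁻¹ : Variable R → ℕ → Carrier
  ⟨ v ⟩⁻¹ n = proj₁ (⟨⟩-unit v n)

  ⟨⟩-inverseʳ : ∀ v n → ⟨ v ⟩ n * ⟨ v ⟩⁻¹ n ≈ 1#
  ⟨⟩-inverseʳ v n = proj₂ (proj₂ (⟨⟩-unit v n))

  ⟨⟩-suc : ∀ v n → ⟨ v ⟩ (suc n) ≈ ⟨ v ⟩ n * (1# - q v ^ suc n)
  ⟨⟩-suc v n = ∏-last n λ i → 1# - q v * q v ^ i

  -- The inverse of a product is built by peeling off the first factor, whereas here the last one is
  -- split off; hence the argument by uniqueness of inverses. In this direction the factor 1 -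
  -- q^(n+1) itself need not be inverted.
  ⟨⟩⁻¹-suc : ∀ v n → ⟨ v ⟩⁻¹ n ≈ (1# - q v ^ suc n) * ⟨ v ⟩⁻¹ (suc n)
  ⟨⟩⁻¹-suc v n = begin
    ⟨ v ⟩⁻¹ n
      ≈⟨ *-identityʳ _ ⟨
    ⟨ v ⟩⁻¹ n * 1#
      ≈⟨ *-congˡ (⟨⟩-inverseʳ v (suc n)) ⟨
    ⟨ v ⟩⁻¹ n * (⟨ v ⟩ (suc n) * ⟨ v ⟩⁻¹ (suc n))
      ≈⟨ *-congˡ (*-congʳ (⟨⟩-suc v n)) ⟩
    ⟨ v ⟩⁻¹ n * (⟨ v ⟩ n * (1# - q v ^ suc n) * ⟨ v ⟩⁻¹ (suc n))
      ≈⟨ solve 4 (λ i x w j → i :* (x :* w :* j) := x :* i :* (w :* j)) refl _ _ _ _ ⟩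
    ⟨ v ⟩ n * ⟨ v ⟩⁻¹ n * ((1# - q v ^ suc n) * ⟨ v ⟩⁻¹ (suc n))
      ≈⟨ trans (*-congʳ (⟨⟩-inverseʳ v n)) (*-identityˡ _) ⟩
    (1# - q v ^ suc n) * ⟨ v ⟩⁻¹ (suc n) ∎

  -- Writing the top as `b + c` makes the range condition automatic and turns the difference of top
  -- and bottom into `c`.
  []-+ : ∀ v b c → [ + (b ℕ.+ c) , + b ] v ≈ ⟨ v ⟩ (b ℕ.+ c) * (⟨ v ⟩⁻¹ b * ⟨ v ⟩⁻¹ c)
  []-+ v b c with (0ℤ ℤₚ.≤? + b) ×-dec (+ b ℤₚ.≤? + (b ℕ.+ c))
  ... | no ¬p = contradiction (+≤+ z≤n , +≤+ (ℕₚ.m≤m+n b c)) ¬p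
  ... | yes _ = reflexive $
    ≡.cong (λ i → ⟨ v ⟩ (b ℕ.+ c) * (⟨ v ⟩⁻¹ b * ⟨ v ⟩⁻¹ ∣ i ∣)) (+[m+n]-+m≡+n b c)

  []-neg : ∀ a b v → b ℤ.< 0ℤ → [ a , b ] v ≈ 0#
  []-neg a b v b<0 with (0ℤ ℤₚ.≤? b) ×-dec (b ℤₚ.≤? a)
  ... | no  _         = refl
  ... | yes (0≤b , _) = contradiction 0≤b (ℤₚ.<⇒≱ b<0)

  []-0 : ∀ v a → [ + a , + 0 ] v ≈ 1#
  []-0 v a = begin
    [ + a , + 0 ] v              ≈⟨ []-+ v 0 a ⟩
    ⟨ v ⟩ a * (1# * ⟨ v ⟩⁻¹ a)   ≈⟨ *-congˡ (*-identityˡ _) ⟩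
    ⟨ v ⟩ a * ⟨ v ⟩⁻¹ a          ≈⟨ ⟨⟩-inverseʳ v a ⟩
    1#                           ∎

  []-diagonal : ∀ v a → [ + a , + a ] v ≈ 1#
  []-diagonal v a = begin
    [ + a , + a ] v                       ≈⟨ reflexive (≡.cong (λ i → [ + i , + a ] v) (ℕₚ.+-identityʳ a)) ⟨
    [ + (a ℕ.+ 0) , + a ] v               ≈⟨ []-+ v a 0 ⟩
    ⟨ v ⟩ (a ℕ.+ 0) * (⟨ v ⟩⁻¹ a * 1#)    ≈⟨ *-cong (reflexive (≡.cong ⟨ v ⟩ (ℕₚ.+-identityʳ a))) (*-identityʳ _) ⟩
    ⟨ v ⟩ a * ⟨ v ⟩⁻¹ a                   ≈⟨ ⟨⟩-inverseʳ v a ⟩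
    1#                                    ∎

  1-xy : ∀ x y → 1# - x * y ≈ (1# - x) + x * (1# - y)
  1-xy x y = sym $ begin
    (1# - x) + x * (1# - y)
      ≈⟨ solve 3 (λ x x⁻ y⁻ → (con 1 :+ x⁻) :+ x :* (con 1 :+ y⁻)
                           := (con 1 :+ x :* y⁻) :+ (x⁻ :+ x)) refl x (- x) (- y) ⟩
    (1# + x * - y) + (- x + x)
      ≈⟨ trans (+-congˡ (-‿inverseˡ x)) (+-identityʳ _) ⟩
    1# + x * - y
      ≈⟨ +-congˡ (-‿distribʳ-* x y) ⟨
    1# - x * y ∎

  -- The rule is 1 - xy = (1 - x) + x (1 - y) with x = q^c and y = q^(b+1), multiplied by the common
  -- factorials. Of the two q-Pascal rules, this one puts the power q^(top - bottom) on the term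
  -- with lowered bottom.
  []-pascal : ∀ v b c → [ + suc (b ℕ.+ c) , + suc b ] v
            ≈ [ + (b ℕ.+ c) , + suc b ] v + q v ^ c * [ + (b ℕ.+ c) , + b ] v
  -- For c = 0 the first term on the right has its bottom above its top, so `[]-+` does not cover
  -- it; the rule reads 1 = 0 + 1.
  []-pascal v b zero rewrite ℕₚ.+-identityʳ b = begin
    [ + suc b , + suc b ] v
      ≈⟨ []-diagonal v (suc b) ⟩
    1#
      ≈⟨ []-diagonal v b ⟨
    [ + b , + b ] v
      ≈⟨ solve 1 (λ x → x := con 0 :+ con 1 :* x) refl _ ⟩
    0# + 1# * [ + b , + b ] v
      ≈⟨ +-congʳ ([]-zero (+ b) (+ suc b) v (+<+ (ℕₚ.n<1+n b))) ⟨
    [ + b , + suc b ] v + 1# * [ + b , + b ] v ∎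
  []-pascal v b (suc c) = begin
    [ + suc n , + suc b ] v
      ≈⟨ []-+ v (suc b) (suc c) ⟩
    ⟨ v ⟩ (suc n) * (i * j)
      ≈⟨ *-congʳ (trans (⟨⟩-suc v n) (*-congˡ split)) ⟩
    ⟨ v ⟩ n * ((1# - x) + x * (1# - y)) * (i * j)
      ≈⟨ solve 6 (λ f w x z i j → f :* (w :+ x :* z) :* (i :* j)
                    := f :* (i :* (w :* j)) :+ x :* (f :* ((z :* i) :* j)))
           refl _ (1# - x) x (1# - y) _ _ ⟩
    ⟨ v ⟩ n * (i * ((1# - x) * j)) + x * (⟨ v ⟩ n * (((1# - y) * i) * j))
      ≈⟨ +-cong (*-congˡ (*-congˡ (⟨⟩⁻¹-suc v c)))
                (*-congˡ (*-congˡ (*-congʳ (⟨⟩⁻¹-suc v b)))) ⟨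
    ⟨ v ⟩ n * (i * ⟨ v ⟩⁻¹ c) + x * (⟨ v ⟩ n * (⟨ v ⟩⁻¹ b * j))
      ≈⟨ +-cong (reflexive (≡.cong (λ n → ⟨ v ⟩ n * (i * ⟨ v ⟩⁻¹ c)) (≡.sym (ℕₚ.+-suc b c))))
                (*-congˡ ([]-+ v b (suc c))) ⟨
    ⟨ v ⟩ (suc b ℕ.+ c) * (i * ⟨ v ⟩⁻¹ c) + x * [ + n , + b ] v
      ≈⟨ +-congʳ ([]-+ v (suc b) c) ⟨
    [ + (suc b ℕ.+ c) , + suc b ] v + x * [ + n , + b ] v
      ≈⟨ +-congʳ (reflexive (≡.cong (λ n → [ + n , + suc b ] v) (ℕₚ.+-suc b c))) ⟨
    [ + n , + suc b ] v + x * [ + n , + b ] v ∎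
    where
    n = b ℕ.+ suc c
    x = q v ^ suc c
    y = q v ^ suc b
    i = ⟨ v ⟩⁻¹ (suc b)
    j = ⟨ v ⟩⁻¹ (suc c)
    split : 1# - q v ^ suc n ≈ (1# - x) + x * (1# - y)
    split = trans (+-congˡ (-‿cong (trans
      (^-congʳ (q v) (≡.trans (≡.cong suc (ℕₚ.+-comm b (suc c))) (≡.sym (ℕₚ.+-suc (suc c) b))))
      (^-homo-* (q v) (suc c) (suc b))))) (1-xy x y)

-- Generating functions for the three summation indices.

module Recurrences {c ℓ} (R : CommutativeRing c ℓ) (v : Variable R) where

  open CommutativeRing R hiding (zero)
  open QSeries R hiding (Variable; HasSum₃; summand; trinomialSum)
  open Variable v using (q)
  open Variable (v ↑ 3) using () renaming (q to Q)
  open Series R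
  open QBinomial R
  open RingProperties ring using (-‿distribˡ-*; -1*x≈-x)
  open Exponentiation semiring using (_^_; ^-homo-*; ^-congʳ; ^-assocʳ)
  open SetoidReasoning setoid
  open SemiringSolver commutativeSemiring using (solve; _:=_; _:+_; _:*_; con)
  open ℕSolver.+-*-Solver using () renaming
    (solve to solveℕ; _:=_ to _:≡_; _:+_ to _⊕_; _:*_ to _⊗_; con to conℕ)

  -- The coefficients of (1 + q³u) (1 + q⁴u) ⋯ (1 + q^(a+2) u), by the finite q-binomial theorem;
  -- `E-0` and `E-suc` establish this product one factor at a time.
  E : ℕ → Seq
  E a m = q ^ (choose₂ m ℕ.+ 3 ℕ.* m) * [ + a , + m ] v

  E-0 : E 0 ≐ δ
  E-0 zero    = trans (*-identityˡ _) ([]-0 v 0)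
  E-0 (suc m) = trans (*-congˡ ([]-zero (+ 0) (+ suc m) v (+<+ (s≤s z≤n)))) (zeroʳ _)

  -- The Pascal factor q^(a-m) cancels the m in C(m+1,2) = m + C(m,2), so what is left over,
  -- q^(3+a), is independent of m and can serve as the coefficient of a linear factor.
  E-suc : ∀ a → E (suc a) ≐ 1+ q ^ (3 ℕ.+ a) · E a
  E-suc a zero = *-congˡ (trans ([]-0 v (suc a)) (sym ([]-0 v a)))
  E-suc a (suc m) with ℕₚ.≤-<-connex m a
  -- Beyond the degree all three q-binomials vanish; the Pascal rule is stated only for m ≤ a.
  ... | inj₂ a<m = begin
    p * [ + suc a , + suc m ] v
      ≈⟨ *-congˡ ([]-zero _ _ v (+<+ (s≤s a<m))) ⟩
    p * 0#
      ≈⟨ solve 3 (λ p r s → p :* con 0 := p :* con 0 :+ r :* (s :* con 0)) refl _ _ _ ⟩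
    p * 0# + r * (s * 0#)
      ≈⟨ +-cong (*-congˡ ([]-zero _ _ v (+<+ (ℕₚ.m<n⇒m<1+n a<m))))
                (*-congˡ (*-congˡ ([]-zero _ _ v (+<+ a<m)))) ⟨
    p * [ + a , + suc m ] v + r * (s * [ + a , + m ] v) ∎
    where
    p = q ^ (choose₂ (suc m) ℕ.+ 3 ℕ.* suc m)
    r = q ^ (3 ℕ.+ a)
    s = q ^ (choose₂ m ℕ.+ 3 ℕ.* m)
  ... | inj₁ m≤a with b , ≡.refl ← ℕₚ.m≤n⇒∃[o]m+o≡n m≤a = begin
    p * [ + suc (m ℕ.+ b) , + suc m ] v
      ≈⟨ *-congˡ ([]-pascal v m b) ⟩
    p * (x + q ^ b * y)
      ≈⟨ solve 4 (λ p x r y → p :* (x :+ r :* y) := p :* x :+ (p :* r) :* y) refl _ _ _ _ ⟩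
    p * x + (p * q ^ b) * y
      ≈⟨ +-congˡ (*-congʳ exponents) ⟩
    p * x + (r * s) * y
      ≈⟨ +-congˡ (*-assoc _ _ _) ⟩
    p * x + r * (s * y) ∎
    where
    x = [ + (m ℕ.+ b) , + suc m ] v
    y = [ + (m ℕ.+ b) , + m ] v
    p = q ^ (choose₂ (suc m) ℕ.+ 3 ℕ.* suc m)
    r = q ^ (3 ℕ.+ (m ℕ.+ b))
    s = q ^ (choose₂ m ℕ.+ 3 ℕ.* m)
    exponents : p * q ^ b ≈ r * s
    exponents = begin
      p * q ^ b ≈⟨ ^-homo-* q (choose₂ (suc m) ℕ.+ 3 ℕ.* suc m) b ⟨
      q ^ (m ℕ.+ choose₂ m ℕ.+ 3 ℕ.* suc m ℕ.+ b)
        ≈⟨ ^-congʳ q (solveℕ 3 (λ m t b → m ⊕ t ⊕ conℕ 3 ⊗ (conℕ 1 ⊕ m) ⊕ b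
             :≡ (conℕ 3 ⊕ (m ⊕ b)) ⊕ (t ⊕ conℕ 3 ⊗ m)) ≡.refl m (choose₂ m) b) ⟩
      q ^ ((3 ℕ.+ (m ℕ.+ b)) ℕ.+ (choose₂ m ℕ.+ 3 ℕ.* m))
        ≈⟨ ^-homo-* q (3 ℕ.+ (m ℕ.+ b)) _ ⟩
      r * s ∎

  X : ℕ → ℕ → Seq
  X d M n = q ^ (d ℕ.* n) * [ + (M ℕ.+ ⌊ n /2⌋) , + ⌊ n /2⌋ ] (v ↑ 6)

  X-0 : ∀ d → 1+ - (q ^ d) · X d 0 ≐ δ
  X-0 d = geometric (q ^ d) (trans (X₀ 0) (^-congʳ q (ℕₚ.*-zeroʳ d))) λ n → begin
    X d 0 (suc n)          ≈⟨ X₀ (suc n) ⟩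
    q ^ (d ℕ.* suc n)      ≈⟨ ^-congʳ q (ℕₚ.*-suc d n) ⟩
    q ^ (d ℕ.+ d ℕ.* n)    ≈⟨ ^-homo-* q d (d ℕ.* n) ⟩
    q ^ d * q ^ (d ℕ.* n)  ≈⟨ *-congˡ (X₀ n) ⟨
    q ^ d * X d 0 n        ∎
    where
    X₀ : ∀ n → X d 0 n ≈ q ^ (d ℕ.* n)
    X₀ n = trans (*-congˡ ([]-diagonal (v ↑ 6) ⌊ n /2⌋)) (*-identityʳ _)

  -- Raising n by two raises ⌊n/2⌋ by one. The Pascal rule in base q⁶ then contributes q^(2d)
  -- (q⁶)^(M+1), which is the square of a = q^(d+3(M+1)).
  X-suc : ∀ d M → let a = q ^ (3 ℕ.+ (d ℕ.+ M ℕ.* 3)) in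
          1+ - a · 1+ a · X d (suc M) ≐ X d M
  X-suc d M = 1+-square a
    (*-congˡ (trans ([]-0 (v ↑ 6) (suc M ℕ.+ 0)) (sym ([]-0 (v ↑ 6) (M ℕ.+ 0)))))
    (*-congˡ (trans ([]-0 (v ↑ 6) (suc M ℕ.+ 0)) (sym ([]-0 (v ↑ 6) (M ℕ.+ 0)))))
    step
    where
    a = q ^ (3 ℕ.+ (d ℕ.+ M ℕ.* 3))
    step : ∀ n → X d (suc M) (suc (suc n)) ≈ X d M (suc (suc n)) + a * a * X d (suc M) n
    step n = begin
      p * [ + (suc M ℕ.+ suc k) , + suc k ] v⁶
        ≈⟨ *-congˡ (reflexive (≡.cong (λ n → [ + n , + suc k ] v⁶)
             (ℕₚ.+-comm (suc M) (suc k)))) ⟩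
      p * [ + suc (k ℕ.+ suc M) , + suc k ] v⁶
        ≈⟨ *-congˡ ([]-pascal v⁶ k (suc M)) ⟩
      p * ([ + (k ℕ.+ suc M) , + suc k ] v⁶ + (q ^ 6) ^ suc M * [ + (k ℕ.+ suc M) , + k ] v⁶)
        ≈⟨ *-congˡ (+-cong
             (reflexive (≡.cong (λ n → [ + n , + suc k ] v⁶)
               (≡.trans (ℕₚ.+-comm k (suc M)) (≡.sym (ℕₚ.+-suc M k)))))
             (*-congˡ (reflexive (≡.cong (λ n → [ + n , + k ] v⁶) (ℕₚ.+-comm k (suc M)))))) ⟩
      p * (x + (q ^ 6) ^ suc M * y)
        ≈⟨ solve 4 (λ p x r y → p :* (x :+ r :* y) := p :* x :+ (p :* r) :* y) refl _ _ _ _ ⟩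
      p * x + (p * (q ^ 6) ^ suc M) * y
        ≈⟨ +-congˡ (*-congʳ exponents) ⟩
      p * x + (a * a * q ^ (d ℕ.* n)) * y
        ≈⟨ +-congˡ (*-assoc _ _ _) ⟩
      p * x + a * a * (q ^ (d ℕ.* n) * y) ∎
      where
      v⁶ = v ↑ 6
      k = ⌊ n /2⌋
      p = q ^ (d ℕ.* suc (suc n))
      x = [ + (M ℕ.+ suc k) , + suc k ] v⁶
      y = [ + (suc M ℕ.+ k) , + k ] v⁶
      exponents : p * (q ^ 6) ^ suc M ≈ a * a * q ^ (d ℕ.* n)
      exponents = begin
        p * (q ^ 6) ^ suc M
          ≈⟨ *-congˡ (^-assocʳ q 6 (suc M)) ⟩
        p * q ^ (6 ℕ.* suc M)
          ≈⟨ ^-homo-* q (d ℕ.* suc (suc n)) _ ⟨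
        q ^ (d ℕ.* suc (suc n) ℕ.+ 6 ℕ.* suc M)
          ≈⟨ ^-congʳ q (solveℕ 3 (λ d n M →
               d ⊗ (conℕ 2 ⊕ n) ⊕ conℕ 6 ⊗ (conℕ 1 ⊕ M)
               :≡ (conℕ 3 ⊕ (d ⊕ M ⊗ conℕ 3)) ⊕ (conℕ 3 ⊕ (d ⊕ M ⊗ conℕ 3)) ⊕ d ⊗ n) ≡.refl d n M) ⟩
        q ^ (e ℕ.+ e ℕ.+ d ℕ.* n)
          ≈⟨ ^-homo-* q (e ℕ.+ e) _ ⟩
        q ^ (e ℕ.+ e) * q ^ (d ℕ.* n)
          ≈⟨ *-congʳ (^-homo-* q e e) ⟩
        a * a * q ^ (d ℕ.* n) ∎
        where e = 3 ℕ.+ (d ℕ.+ M ℕ.* 3)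

  H : ℕ → Seq
  H M = E (M ℕ.* 3) ⋆ X 1 M ⋆ X 2 M

  1+-⋆ˡʳ : ∀ a f g h → f ⋆ (1+ a · g) ⋆ h ≐ 1+ a · f ⋆ g ⋆ h
  1+-⋆ˡʳ a f g h n = trans (⋆-cong (λ _ → refl) (1+-⋆ˡ a g h) n) (1+-⋆ʳ a f (g ⋆ h) n)

  1+-⋆ʳʳ : ∀ a f g h → f ⋆ g ⋆ (1+ a · h) ≐ 1+ a · f ⋆ g ⋆ h
  1+-⋆ʳʳ a f g h n = trans (⋆-cong (λ _ → refl) (1+-⋆ʳ a g h) n) (1+-⋆ʳ a f (g ⋆ h) n)

  H-0 : 1+ - (q ^ 1) · 1+ - (q ^ 2) · H 0 ≐ δ
  H-0 n = begin
    (1+ - (q ^ 1) · 1+ - (q ^ 2) · H 0) n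
      ≈⟨ 1+-congˡ (1+-⋆ʳʳ _ (E 0) (X 1 0) (X 2 0)) n ⟨
    (1+ - (q ^ 1) · E 0 ⋆ X 1 0 ⋆ (1+ - (q ^ 2) · X 2 0)) n
      ≈⟨ 1+-⋆ˡʳ _ (E 0) (X 1 0) _ n ⟨
    (E 0 ⋆ (1+ - (q ^ 1) · X 1 0) ⋆ (1+ - (q ^ 2) · X 2 0)) n
      ≈⟨ ⋆-cong E-0 (⋆-cong (X-0 1) (X-0 2)) n ⟩
    (δ ⋆ δ ⋆ δ) n
      ≈⟨ ⋆-identityˡ (δ ⋆ δ) n ⟩
    (δ ⋆ δ) n
      ≈⟨ ⋆-identityˡ δ n ⟩
    δ n ∎

  -- X 1 and X 2 bring in the factors 1 - a² u² and 1 - b² u²; their halves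
  -- 1 + a u and 1 + b u also come from E and cancel.
  H-suc : ∀ M → 1+ - (q ^ (4 ℕ.+ M ℕ.* 3)) · 1+ - (q ^ (5 ℕ.+ M ℕ.* 3)) · H (suc M)
              ≐ 1+ q ^ (3 ℕ.+ M ℕ.* 3) · H M
  H-suc M = 1+-cancel b (1+-cancel a λ n → begin
    (1+ a · 1+ b · 1+ - a · 1+ - b · h) n
      ≈⟨ 1+-congˡ (1+-comm b (- a) _) n ⟩
    (1+ a · 1+ - a · 1+ b · 1+ - b · h) n
      ≈⟨ 1+-comm a (- a) _ n ⟩
    (1+ - a · 1+ a · 1+ b · 1+ - b · h) n
      ≈⟨ 1+-congˡ (1+-congˡ (1+-comm b (- b) h)) n ⟩
    (1+ - a · 1+ a · 1+ - b · 1+ b · h) n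
      ≈⟨ 1+-congˡ (1+-congˡ (1+-congˡ (1+-⋆ʳʳ b e x y))) n ⟨
    (1+ - a · 1+ a · 1+ - b · e ⋆ x ⋆ (1+ b · y)) n
      ≈⟨ 1+-congˡ (1+-congˡ (1+-⋆ʳʳ (- b) e x _)) n ⟨
    (1+ - a · 1+ a · e ⋆ x ⋆ (1+ - b · 1+ b · y)) n
      ≈⟨ 1+-congˡ (1+-⋆ˡʳ a e x _) n ⟨
    (1+ - a · e ⋆ (1+ a · x) ⋆ (1+ - b · 1+ b · y)) n
      ≈⟨ 1+-⋆ˡʳ (- a) e (1+ a · x) _ n ⟨
    (e ⋆ (1+ - a · 1+ a · x) ⋆ (1+ - b · 1+ b · y)) n
      ≈⟨ ⋆-cong e-suc (⋆-cong (X-suc 1 M) (X-suc 2 M)) n ⟩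
    ((1+ b · 1+ a · 1+ d · E (M ℕ.* 3)) ⋆ X 1 M ⋆ X 2 M) n
      ≈⟨ 1+-⋆ˡ b _ _ n ⟩
    (1+ b · (1+ a · 1+ d · E (M ℕ.* 3)) ⋆ X 1 M ⋆ X 2 M) n
      ≈⟨ 1+-congˡ (1+-⋆ˡ a _ _) n ⟩
    (1+ b · 1+ a · (1+ d · E (M ℕ.* 3)) ⋆ X 1 M ⋆ X 2 M) n
      ≈⟨ 1+-congˡ (1+-congˡ (1+-⋆ˡ d _ _)) n ⟩
    (1+ b · 1+ a · 1+ d · H M) n
      ≈⟨ 1+-comm b a _ n ⟩
    (1+ a · 1+ b · 1+ d · H M) n ∎)
    where
    a = q ^ (4 ℕ.+ M ℕ.* 3)
    b = q ^ (5 ℕ.+ M ℕ.* 3)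
    d = q ^ (3 ℕ.+ M ℕ.* 3)
    e = E (suc M ℕ.* 3)
    x = X 1 (suc M)
    y = X 2 (suc M)
    h = H (suc M)
    e-suc : e ≐ 1+ b · 1+ a · 1+ d · E (M ℕ.* 3)
    e-suc n = begin
      e n                                          ≈⟨ E-suc (2 ℕ.+ M ℕ.* 3) n ⟩
      (1+ b · E (2 ℕ.+ M ℕ.* 3)) n                 ≈⟨ 1+-congˡ (E-suc (1 ℕ.+ M ℕ.* 3)) n ⟩
      (1+ b · 1+ a · E (1 ℕ.+ M ℕ.* 3)) n          ≈⟨ 1+-congˡ (1+-congˡ (E-suc (M ℕ.* 3))) n ⟩
      (1+ b · 1+ a · 1+ d · E (M ℕ.* 3)) n         ∎

  -- The weighted sum over l + M = N and its recurrence.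

  w : ℕ → Carrier
  w l = Q ^ choose₂ l

  S : (ℕ → Seq) → ℕ → Carrier
  S h = antidiagonal λ l M → w l * h M l

  -- Raising l by one multiplies the weight by Q^l, and Q^l Q^M = Q^N is constant along the
  -- antidiagonal. A factor 1 + x Q^M u, which varies with M, therefore acts on the sums as an
  -- operator that involves N alone.
  S-1+ : ∀ x h N → S (λ M → 1+ x * Q ^ M · h M) (suc N) ≈ S h (suc N) + x * Q ^ N * S h N
  S-1+ x h N = begin
    w 0 * h (suc N) 0 + antidiagonal (λ l M → w (suc l) * (h M (suc l) + x * Q ^ M * h M l)) N
      ≈⟨ +-congˡ (antidiagonal-cong N term) ⟩
    w 0 * h (suc N) 0 + antidiagonal (λ l M → w (suc l) * h M (suc l) + x * Q ^ N * (w l * h M l)) N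
      ≈⟨ +-congˡ (trans (antidiagonal-+ N) (+-congˡ (antidiagonal-* N (x * Q ^ N)))) ⟩
    w 0 * h (suc N) 0 + (antidiagonal (λ l M → w (suc l) * h M (suc l)) N + x * Q ^ N * S h N)
      ≈⟨ +-assoc _ _ _ ⟨
    S h (suc N) + x * Q ^ N * S h N ∎
    where
    term : ∀ l M → l ℕ.+ M ≡ N → w (suc l) * (h M (suc l) + x * Q ^ M * h M l)
                               ≈ w (suc l) * h M (suc l) + x * Q ^ N * (w l * h M l)
    term l M ≡.refl = begin
      w (suc l) * (h M (suc l) + x * Q ^ M * h M l)
        ≈⟨ distribˡ _ _ _ ⟩
      w (suc l) * h M (suc l) + w (suc l) * (x * Q ^ M * h M l)
        ≈⟨ +-congˡ (*-congʳ (^-homo-* Q l (choose₂ l))) ⟩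
      w (suc l) * h M (suc l) + Q ^ l * w l * (x * Q ^ M * h M l)
        ≈⟨ +-congˡ (solve 5 (λ a w x b h → a :* w :* (x :* b :* h)
                                        := x :* (a :* b) :* (w :* h)) refl _ _ _ _ _) ⟩
      w (suc l) * h M (suc l) + x * (Q ^ l * Q ^ M) * (w l * h M l)
        ≈⟨ +-congˡ (*-congʳ (*-congˡ (^-homo-* Q l M))) ⟨
      w (suc l) * h M (suc l) + x * Q ^ (l ℕ.+ M) * (w l * h M l) ∎

  -- Shifting M by one lets the relation between consecutive series be summed along the same
  -- antidiagonal, including its end M = 0.
  delay : (ℕ → Seq) → ℕ → Seq
  delay h zero    = λ _ → 0#
  delay h (suc M) = h M

  S-delay-0 : ∀ h → S (delay h) 0 ≈ 0#
  S-delay-0 h = zeroʳ _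

  S-delay : ∀ h N → S (delay h) (suc N) ≈ S h N
  S-delay h N = begin
    S (delay h) (suc N)             ≈⟨ antidiagonal-last N (λ l M → w l * delay h M l) ⟩
    S h N + w (suc N) * 0#          ≈⟨ trans (+-congˡ (zeroʳ _)) (+-identityʳ _) ⟩
    S h N                           ∎

  -- This is (1 - q Q^M u) (1 - q² Q^M u) H_M = (1 + Q^M u) H_{M-1} summed with weights, each linear
  -- factor being turned into an operator by `S-1+`. The last sum on the left stays unexpanded
  -- because `S-1+` needs a positive index: at N = 0 it is just `S H 0`, and later it is expanded
  -- once more.
  S-suc : ∀ N → S H (suc N) + - (q * q) * Q ^ N * S H N
              + - q * Q ^ N * S (λ M → 1+ - (q * q) * Q ^ M · H M) N
              ≈ S H N + Q ^ N * S (delay H) N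
  S-suc N = begin
    S H (suc N) + - (q * q) * Q ^ N * S H N + - q * Q ^ N * S G N
      ≈⟨ +-congʳ (S-1+ (- (q * q)) H N) ⟨
    S G (suc N) + - q * Q ^ N * S G N
      ≈⟨ S-1+ (- q) G N ⟨
    S (λ M → 1+ - q * Q ^ M · G M) (suc N)
      ≈⟨ antidiagonal-cong (suc N) term ⟩
    S (λ M → 1+ 1# * Q ^ M · delay H M) (suc N)
      ≈⟨ S-1+ 1# (delay H) N ⟩
    S (delay H) (suc N) + 1# * Q ^ N * S (delay H) N
      ≈⟨ +-cong (S-delay H N) (*-congʳ (*-identityˡ _)) ⟩
    S H N + Q ^ N * S (delay H) N ∎
    where
    G : ℕ → Seq
    G M = 1+ - (q * q) * Q ^ M · H M
    shifted : ∀ k M → - (q ^ k) * Q ^ M ≈ - (q ^ (k ℕ.+ M ℕ.* 3))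
    shifted k M = begin
      - (q ^ k) * Q ^ M              ≈⟨ -‿distribˡ-* _ _ ⟨
      - (q ^ k * (q ^ 3) ^ M)        ≈⟨ -‿cong (*-congˡ (^-assocʳ q 3 M)) ⟩
      - (q ^ k * q ^ (3 ℕ.* M))      ≈⟨ -‿cong (^-homo-* q k _) ⟨
      - (q ^ (k ℕ.+ 3 ℕ.* M))        ≈⟨ -‿cong (^-congʳ q (≡.cong (k ℕ.+_) (ℕₚ.*-comm 3 M))) ⟩
      - (q ^ (k ℕ.+ M ℕ.* 3))        ∎
    G′ : ∀ M → 1+ - q * Q ^ M · G M
             ≐ 1+ - (q ^ (1 ℕ.+ M ℕ.* 3)) · 1+ - (q ^ (2 ℕ.+ M ℕ.* 3)) · H M
    G′ M = 1+-cong (trans (*-congʳ (-‿cong (sym (*-identityʳ q)))) (shifted 1 M))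
             (1+-cong (trans (*-congʳ (-‿cong (*-congˡ (sym (*-identityʳ q))))) (shifted 2 M))
                      (λ _ → refl))
    term : ∀ l M → l ℕ.+ M ≡ suc N →
           w l * (1+ - q * Q ^ M · G M) l ≈ w l * (1+ 1# * Q ^ M · delay H M) l
    -- At M = 0 the left series is `δ` and the right one is 0. They differ only in the coefficient l
    -- = 0, which `l + M ≡ suc N` excludes.
    term (suc l) zero _ = *-congˡ $ begin
      (1+ - q * Q ^ 0 · G 0) (suc l)  ≈⟨ G′ 0 (suc l) ⟩
      _                               ≈⟨ H-0 (suc l) ⟩
      0#                              ≈⟨ trans (+-identityˡ _) (zeroʳ _) ⟨
      0# + 1# * Q ^ 0 * 0#            ∎
    term l (suc M) _ = *-congˡ $ begin
      (1+ - q * Q ^ suc M · G (suc M)) l     ≈⟨ G′ (suc M) l ⟩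
      _                                      ≈⟨ H-suc M l ⟩
      (1+ q ^ (suc M ℕ.* 3) · H M) l         ≈⟨ 1+-cong Q^ (λ _ → refl) l ⟩
      (1+ 1# * Q ^ suc M · H M) l            ∎
      where
      Q^ : q ^ (suc M ℕ.* 3) ≈ 1# * Q ^ suc M
      Q^ = begin
        q ^ (suc M ℕ.* 3)  ≈⟨ ^-congʳ q (ℕₚ.*-comm (suc M) 3) ⟩
        q ^ (3 ℕ.* suc M)  ≈⟨ ^-assocʳ q 3 (suc M) ⟨
        Q ^ suc M          ≈⟨ *-identityˡ _ ⟨
        1# * Q ^ suc M     ∎

  S-0 : S H 0 ≈ 1#
  S-0 = trans (*-identityˡ _) (H-0 0)

  S-suc′ : ∀ N → S H (suc N) ≈ S H N + Q ^ N * S (delay H) N + q * q * Q ^ N * S H N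
                 + q * Q ^ N * S (λ M → 1+ - (q * q) * Q ^ M · H M) N
  S-suc′ N = trans (sym (trans
    (solve 8 (λ y u u⁻ r r⁻ x a g →
       y :+ u⁻ :* x :* a :+ r⁻ :* x :* g :+ u :* x :* a :+ r :* x :* g
         := y :+ (u⁻ :+ u) :* (x :* a) :+ (r⁻ :+ r) :* (x :* g))
      refl (S H (suc N)) (q * q) (- (q * q)) q (- q) (Q ^ N) (S H N) _)
    (trans (+-cong (+-congˡ (trans (*-congʳ (-‿inverseˡ _)) (zeroˡ _)))
                   (trans (*-congʳ (-‿inverseˡ _)) (zeroˡ _)))
           (trans (+-identityʳ _) (+-identityʳ _)))))
    (+-congʳ (+-congʳ (S-suc N)))

  S-1 : S H 1 ≈ 1# + q + q * q
  S-1 = begin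
    S H 1
      ≈⟨ S-suc′ 0 ⟩
    S H 0 + 1# * S (delay H) 0 + q * q * 1# * S H 0 + q * 1# * S H 0
      ≈⟨ +-cong (+-cong (+-cong S-0 (*-congˡ (S-delay-0 H))) (*-congˡ S-0)) (*-congˡ S-0) ⟩
    1# + 1# * 0# + q * q * 1# * 1# + q * 1# * 1#
      ≈⟨ solve 1 (λ q → con 1 :+ con 1 :* con 0 :+ q :* q :* con 1 :* con 1 :+ q :* con 1 :* con 1
                     := con 1 :+ q :+ q :* q) refl q ⟩
    1# + q + q * q ∎

  SchurRecurrence : Seq → Set ℓ
  SchurRecurrence s = ∀ N → s (2 ℕ.+ N) ≈
    (1# + (q + q * q) * Q ^ suc N) * s (suc N) + Q ^ suc N * (1# - Q ^ suc N) * s N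

  S-recurrence : SchurRecurrence (S H)
  S-recurrence N = begin
    S H (2 ℕ.+ N)
      ≈⟨ S-suc′ (suc N) ⟩
    a + x * S (delay H) (suc N) + q * q * x * a + q * x * S (λ M → 1+ - (q * q) * Q ^ M · H M) (suc N)
      ≈⟨ +-cong (+-congʳ (+-congˡ (*-congˡ (S-delay H N)))) (*-congˡ (S-1+ (- (q * q)) H N)) ⟩
    a + x * b + q * q * x * a + q * x * (a + - (q * q) * z * b)
      ≈⟨ solve 6 (λ a b x q u z →
           a :+ x :* b :+ q :* q :* x :* a :+ q :* x :* (a :+ u :* z :* b)
             := (con 1 :+ (q :+ q :* q) :* x) :* a :+ x :* (con 1 :+ u :* (q :* z)) :* b)
           refl a b x q (- (q * q)) z ⟩
    (1# + (q + q * q) * x) * a + x * (1# + - (q * q) * (q * z)) * b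
      ≈⟨ +-congˡ (*-congʳ (*-congˡ (+-congˡ x⁻))) ⟩
    (1# + (q + q * q) * x) * a + x * (1# - x) * b ∎
    where
    a = S H (suc N)
    b = S H N
    x = Q ^ suc N
    z = Q ^ N
    -- Here Q = q³ enters: the two denominator coefficients q and q² multiply to give q³ Q^N =
    -- Q^(N+1).
    x⁻ : - (q * q) * (q * z) ≈ - x
    x⁻ = trans (sym (-‿distribˡ-* _ _)) (-‿cong
      (solve 2 (λ q z → q :* q :* (q :* z) := (q :* (q :* (q :* con 1))) :* z) refl q z))

  schurRecurrence-unique : ∀ {s t} → s 0 ≈ t 0 → s 1 ≈ t 1 →
                           SchurRecurrence s → SchurRecurrence t → s ≐ t
  schurRecurrence-unique s₀≈t₀ s₁≈t₁ s-rec t-rec zero          = s₀≈t₀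
  schurRecurrence-unique s₀≈t₀ s₁≈t₁ s-rec t-rec (suc zero)    = s₁≈t₁
  schurRecurrence-unique s₀≈t₀ s₁≈t₁ s-rec t-rec (suc (suc N)) = trans (s-rec N) (trans
    (+-cong (*-congˡ (schurRecurrence-unique s₀≈t₀ s₁≈t₁ s-rec t-rec (suc N)))
            (*-congˡ (schurRecurrence-unique s₀≈t₀ s₁≈t₁ s-rec t-rec N)))
    (sym (t-rec N)))

  -- Euler's series and the recurrence for the right side.

  Γ : ℕ → Carrier
  Γ = ⟨ v ↑ 3 ⟩⁻¹

  -- Euler's expansion of (-q^d t; Q)_∞, since `penta d k` equals d k + 3 C(k,2); likewise `Γ` is
  -- that of 1 / (t; Q)_∞.
  B : ℕ → Seq
  B d k = q ^ penta d k * Γ k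

  T : ℕ → Carrier
  T N = ⟨ v ↑ 3 ⟩ N * (B 2 ⋆ B 1 ⋆ Γ) N

  -- The functional equation f(t) = (1 + q^d t) f(Qt) stands in for the infinite product. Over the
  -- common denominator (Q;Q)_{k+1} it reduces to Q^(k+1) + (1 - Q^(k+1)) = 1.
  B-suc : ∀ d → B d ≐ 1+ q ^ d · dilate Q (B d)
  B-suc d zero    = sym (*-identityˡ _)
  B-suc d (suc k) = sym $ begin
    Q ^ suc k * (p * g) + q ^ d * (Q ^ k * (r * Γ k))
      ≈⟨ +-congˡ (*-congˡ (*-congˡ (*-congˡ (⟨⟩⁻¹-suc (v ↑ 3) k)))) ⟩
    Q ^ suc k * (p * g) + q ^ d * (Q ^ k * (r * ((1# - Q ^ suc k) * g)))
      ≈⟨ solve 7 (λ x p g a z r y → x :* (p :* g) :+ a :* (z :* (r :* (y :* g)))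
                     := x :* (p :* g) :+ y :* ((a :* z :* r) :* g)) refl _ _ _ _ _ _ _ ⟩
    Q ^ suc k * (p * g) + (1# - Q ^ suc k) * ((q ^ d * Q ^ k * r) * g)
      ≈⟨ +-congˡ (*-congˡ (*-congʳ exponents)) ⟩
    Q ^ suc k * (p * g) + (1# - Q ^ suc k) * (p * g)
      ≈⟨ solve 3 (λ x y z → x :* z :+ y :* z := (y :+ x) :* z) refl _ _ _ ⟩
    (1# - Q ^ suc k + Q ^ suc k) * (p * g)
      ≈⟨ trans (*-congʳ (+-cancel-neg 1# _)) (*-identityˡ _) ⟩
    p * g ∎
    where
    p = q ^ penta d (suc k)
    r = q ^ penta d k
    g = Γ (suc k)
    exponents : q ^ d * Q ^ k * r ≈ p
    exponents = begin
      q ^ d * Q ^ k * r            ≈⟨ *-congʳ (*-congˡ (^-assocʳ q 3 k)) ⟩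
      q ^ d * q ^ (3 ℕ.* k) * r    ≈⟨ *-congʳ (^-homo-* q d _) ⟨
      q ^ (d ℕ.+ 3 ℕ.* k) * r      ≈⟨ ^-homo-* q (d ℕ.+ 3 ℕ.* k) _ ⟨
      p                            ∎

  Γ-suc : 1+ - 1# · Γ ≐ dilate Q Γ
  Γ-suc zero    = sym (*-identityˡ _)
  Γ-suc (suc k) = begin
    g + - 1# * Γ k
      ≈⟨ +-congˡ (trans (-1*x≈-x _) (-‿cong (⟨⟩⁻¹-suc (v ↑ 3) k))) ⟩
    g - y * g
      ≈⟨ +-congʳ (trans (*-congʳ (+-cancel-neg 1# x)) (*-identityˡ _)) ⟨
    (y + x) * g - y * g
      ≈⟨ solve 4 (λ y x g u → (y :+ x) :* g :+ u := x :* g :+ (u :+ y :* g)) refl y x g _ ⟩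
    x * g + (- (y * g) + y * g)
      ≈⟨ trans (+-congˡ (-‿inverseˡ _)) (+-identityʳ _) ⟩
    x * g ∎
    where
    x = Q ^ suc k
    y = 1# - x
    g = Γ (suc k)

  BBΓ : Seq
  BBΓ = B 2 ⋆ B 1 ⋆ Γ

  BBΓ-suc : 1+ - 1# · BBΓ ≐ 1+ q ^ 2 · 1+ q ^ 1 · dilate Q BBΓ
  BBΓ-suc n = begin
    (1+ - 1# · BBΓ) n
      ≈⟨ 1+-⋆ʳʳ (- 1#) (B 2) (B 1) Γ n ⟨
    (B 2 ⋆ B 1 ⋆ (1+ - 1# · Γ)) n
      ≈⟨ ⋆-cong (B-suc 2) (⋆-cong (B-suc 1) Γ-suc) n ⟩
    ((1+ q ^ 2 · B₂) ⋆ (1+ q ^ 1 · B₁) ⋆ dilate Q Γ) n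
      ≈⟨ 1+-⋆ˡ (q ^ 2) B₂ _ n ⟩
    (1+ q ^ 2 · B₂ ⋆ (1+ q ^ 1 · B₁) ⋆ dilate Q Γ) n
      ≈⟨ 1+-congˡ (1+-⋆ˡʳ (q ^ 1) B₂ B₁ _) n ⟩
    (1+ q ^ 2 · 1+ q ^ 1 · B₂ ⋆ B₁ ⋆ dilate Q Γ) n
      ≈⟨ 1+-congˡ (1+-congˡ dilated) n ⟩
    (1+ q ^ 2 · 1+ q ^ 1 · dilate Q BBΓ) n ∎
    where
    B₂ = dilate Q (B 2)
    B₁ = dilate Q (B 1)
    dilated : B₂ ⋆ B₁ ⋆ dilate Q Γ ≐ dilate Q BBΓ
    dilated n = trans (⋆-cong (λ _ → refl) (dilate-⋆ Q (B 1) Γ) n) (dilate-⋆ Q (B 2) _ n)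

  T-0 : T 0 ≈ 1#
  T-0 = solve 0 (con 1 :* ((con 1 :* con 1) :* ((con 1 :* con 1) :* con 1)) := con 1) refl

  -- Moving the top coefficient of F(Qt) to the left produces 1 - Q^(n+1), exactly the factor by
  -- which (Q;Q)_n grows; this is why `T` carries (Q;Q)_N. The remainder `y` is left free because it
  -- has fewer terms at n = 0 than later.
  BBΓ-step : ∀ n {y} → (1+ - 1# · BBΓ) (suc n) ≈ Q ^ suc n * BBΓ (suc n) + y →
             (1# - Q ^ suc n) * BBΓ (suc n) ≈ BBΓ n + y
  BBΓ-step n {y} eq = begin
    (1# - u) * r               ≈⟨ solve 3 (λ u u⁻ r → (con 1 :+ u⁻) :* r := r :+ u⁻ :* r) refl u (- u) r ⟩
    r + - u * r                ≈⟨ +-congˡ (-‿distribˡ-* u r) ⟨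
    r - u * r                  ≈⟨ +-congʳ (+-cancel-neg r s) ⟨
    (r - s) + s - u * r        ≈⟨ +-congʳ (+-congʳ (+-congˡ (-1*x≈-x s))) ⟨
    (r + - 1# * s) + s - u * r ≈⟨ +-congʳ (+-congʳ eq) ⟩
    (u * r + y) + s - u * r    ≈⟨ solve 4 (λ a b c d → (a :+ b) :+ c :+ d := (c :+ b) :+ (d :+ a)) refl _ _ _ _ ⟩
    (s + y) + (- (u * r) + u * r) ≈⟨ trans (+-congˡ (-‿inverseˡ _)) (+-identityʳ _) ⟩
    s + y                      ∎
    where
    u = Q ^ suc n
    r = BBΓ (suc n)
    s = BBΓ n

  T-1 : T 1 ≈ 1# + q + q * q
  T-1 = begin
    ⟨ v ↑ 3 ⟩ 1 * BBΓ 1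
      ≈⟨ *-congʳ (trans (⟨⟩-suc (v ↑ 3) 0) (*-identityˡ _)) ⟩
    (1# - Q ^ 1) * BBΓ 1
      ≈⟨ BBΓ-step 0 (trans (BBΓ-suc 1) (+-assoc _ _ _)) ⟩
    BBΓ 0 + (q ^ 1 * (1# * BBΓ 0) + q ^ 2 * (1# * BBΓ 0))
      ≈⟨ +-cong BBΓ-0 (+-cong (*-congˡ (*-congˡ BBΓ-0)) (*-congˡ (*-congˡ BBΓ-0))) ⟩
    1# + (q ^ 1 * (1# * 1#) + q ^ 2 * (1# * 1#))
      ≈⟨ solve 1 (λ q → con 1 :+ ((q :* con 1) :* (con 1 :* con 1) :+ (q :* (q :* con 1)) :* (con 1 :* con 1))
                    := con 1 :+ q :+ q :* q) refl q ⟩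
    1# + q + q * q ∎
    where
    BBΓ-0 : BBΓ 0 ≈ 1#
    BBΓ-0 = trans (sym (*-identityˡ _)) T-0

  T-recurrence : SchurRecurrence T
  T-recurrence N = begin
    ⟨ v³ ⟩ (2 ℕ.+ N) * BBΓ (2 ℕ.+ N)
      ≈⟨ trans (*-congʳ (⟨⟩-suc v³ (suc N))) (*-assoc _ _ _) ⟩
    f₁ * ((1# - Q ^ suc (suc N)) * BBΓ (2 ℕ.+ N))
      ≈⟨ *-congˡ (BBΓ-step (suc N) (trans (BBΓ-suc (2 ℕ.+ N)) (+-assoc _ _ _))) ⟩
    f₁ * (r₁ + (q ^ 1 * (x * r₁) + q ^ 2 * (x * r₁ + q ^ 1 * (z * r₀))))
      ≈⟨ solve 5 (λ f₁ q z r₁ r₀ →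
           f₁ :* (r₁ :+ ((q :* con 1) :* (Q′ q :* z :* r₁)
             :+ (q :* (q :* con 1)) :* (Q′ q :* z :* r₁ :+ (q :* con 1) :* (z :* r₀))))
           := (con 1 :+ (q :+ q :* q) :* (Q′ q :* z)) :* (f₁ :* r₁) :+ (Q′ q :* z) :* f₁ :* r₀)
           refl f₁ q z r₁ r₀ ⟩
    (1# + (q + q * q) * x) * (f₁ * r₁) + x * f₁ * r₀
      ≈⟨ +-congˡ (*-congʳ (*-congˡ (⟨⟩-suc v³ N))) ⟩
    (1# + (q + q * q) * x) * (f₁ * r₁) + x * (f₀ * (1# - x)) * r₀
      ≈⟨ +-congˡ (solve 4 (λ x f y r → x :* (f :* y) :* r := x :* y :* (f :* r)) refl _ _ _ _) ⟩
    (1# + (q + q * q) * x) * T (suc N) + x * (1# - x) * T N ∎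
    where
    v³ = v ↑ 3
    f₀ = ⟨ v³ ⟩ N
    f₁ = ⟨ v³ ⟩ (suc N)
    r₀ = BBΓ N
    r₁ = BBΓ (suc N)
    x = Q ^ suc N
    z = Q ^ N
    Q′ = λ q → q :* (q :* (q :* con 1))

  S≐T : S H ≐ T
  S≐T = schurRecurrence-unique (trans S-0 (sym T-0)) (trans S-1 (sym T-1)) S-recurrence T-recurrence

-- The two sides of the identity as `S H` and `T`.

module Identity {c ℓ} (R : CommutativeRing c ℓ) (v : Variable R) where

  open CommutativeRing R hiding (zero)
  open QSeries R hiding (Variable; HasSum₃; summand; trinomialSum)
  open Variable v using (q)
  open Variable (v ↑ 3) using () renaming (q to Q)
  open Series R
  open QBinomial R
  open Recurrences R v
  open Exponents
  open Exponentiation semiring using (_^_; ^-homo-*; ^-congʳ; ^-assocʳ)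
  open SetoidReasoning setoid
  open SemiringSolver commutativeSemiring using (solve; _:=_; _:+_; _:*_; con)

  summandAt : ℤ → (m n₁ n₂ : ℕ) → Carrier
  summandAt M m n₁ n₂ = v ^ᶻ A n₁ n₂ m * [ + 3 ℤ.* M , + m ] v
    * [ M ℤ.+ + ⌊ n₁ /2⌋ , + ⌊ n₁ /2⌋ ] (v ↑ 6) * [ M ℤ.+ + ⌊ n₂ /2⌋ , + ⌊ n₂ /2⌋ ] (v ↑ 6)

  minus-sum : ∀ N m n₁ n₂ →
              N ℤ.- + m ℤ.- + n₁ ℤ.- + n₂ ≡ N ℤ.- + (m ℕ.+ (n₁ ℕ.+ n₂))
  minus-sum N m n₁ n₂ = ℤS.solve 4 (λ N m x y → N :- m :- x :- y ℤS.:= N :- (m ℤS.:+ (x ℤS.:+ y)))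
    ≡.refl N (+ m) (+ n₁) (+ n₂)
    where
    module ℤS = ℤSolver.+-*-Solver
    open ℤS using (_:-_)

  -- When l exceeds N, 3𝒩 < 0 ≤ m and the first q-binomial vanishes. This gives the finite support
  -- and also settles negative N.
  summand-zero : ∀ N m n₁ n₂ → N ℤ.< + (m ℕ.+ (n₁ ℕ.+ n₂)) → summand R v N m n₁ n₂ ≈ 0#
  summand-zero N m n₁ n₂ N<l = begin
    summand R v N m n₁ n₂
      ≈⟨ reflexive (≡.cong (λ M → summandAt M m n₁ n₂) (minus-sum N m n₁ n₂)) ⟩
    summandAt M m n₁ n₂
      ≈⟨ *-congʳ (*-congʳ (*-congˡ ([]-zero (+ 3 ℤ.* M) (+ m) v
           (ℤₚ.<-≤-trans (ℤₚ.*-monoˡ-<-pos (+ 3) M<0) (+≤+ z≤n))))) ⟩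
    v ^ᶻ A n₁ n₂ m * 0# * _ * _
      ≈⟨ solve 3 (λ a b c → a :* con 0 :* b :* c := con 0) refl _ _ _ ⟩
    0# ∎
    where
    l = m ℕ.+ (n₁ ℕ.+ n₂)
    M = N ℤ.- + l
    M<0 : M ℤ.< 0ℤ
    M<0 = ≡.subst (M ℤ.<_) (ℤₚ.+-inverseʳ (+ l)) (ℤₚ.+-monoˡ-< (ℤ.- + l) N<l)

  summand-term : ∀ m n₁ n₂ M → let l = m ℕ.+ (n₁ ℕ.+ n₂) in
    summand R v (+ (l ℕ.+ M)) m n₁ n₂ ≈ w l * (E (M ℕ.* 3) m * (X 1 M n₁ * X 2 M n₂))
  summand-term m n₁ n₂ M = begin
    summand R v (+ (l ℕ.+ M)) m n₁ n₂
      ≈⟨ reflexive (≡.cong (λ M → summandAt M m n₁ n₂)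
           (≡.trans (minus-sum (+ (l ℕ.+ M)) m n₁ n₂) (+[m+n]-+m≡+n l M))) ⟩
    summandAt (+ M) m n₁ n₂
      ≈⟨ *-congʳ (*-congʳ (*-cong (reflexive (≡.cong (v ^ᶻ_) (A-value n₁ n₂ m)))
           (reflexive (≡.cong (λ i → [ i , + m ] v)
             (≡.trans (≡.sym (ℤₚ.pos-* 3 M)) (≡.cong +_ (ℕₚ.*-comm 3 M))))))) ⟩
    q ^ (3 ℕ.* choose₂ l ℕ.+ (e ℕ.+ (1 ℕ.* n₁ ℕ.+ 2 ℕ.* n₂))) * b * b₁ * b₂
      ≈⟨ *-congʳ (*-congʳ (*-congʳ powers)) ⟩
    w l * (q ^ e * (q ^ (1 ℕ.* n₁) * q ^ (2 ℕ.* n₂))) * b * b₁ * b₂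
      ≈⟨ solve 7 (λ w x y z b b₁ b₂ → w :* (x :* (y :* z)) :* b :* b₁ :* b₂
                    := w :* ((x :* b) :* ((y :* b₁) :* (z :* b₂)))) refl _ _ _ _ _ _ _ ⟩
    w l * (E (M ℕ.* 3) m * (X 1 M n₁ * X 2 M n₂)) ∎
    where
    l = m ℕ.+ (n₁ ℕ.+ n₂)
    e = choose₂ m ℕ.+ 3 ℕ.* m
    b = [ + (M ℕ.* 3) , + m ] v
    b₁ = [ + (M ℕ.+ ⌊ n₁ /2⌋) , + ⌊ n₁ /2⌋ ] (v ↑ 6)
    b₂ = [ + (M ℕ.+ ⌊ n₂ /2⌋) , + ⌊ n₂ /2⌋ ] (v ↑ 6)
    powers : q ^ (3 ℕ.* choose₂ l ℕ.+ (e ℕ.+ (1 ℕ.* n₁ ℕ.+ 2 ℕ.* n₂)))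
           ≈ w l * (q ^ e * (q ^ (1 ℕ.* n₁) * q ^ (2 ℕ.* n₂)))
    powers = begin
      q ^ (3 ℕ.* choose₂ l ℕ.+ (e ℕ.+ (1 ℕ.* n₁ ℕ.+ 2 ℕ.* n₂)))
        ≈⟨ ^-homo-* q (3 ℕ.* choose₂ l) _ ⟩
      q ^ (3 ℕ.* choose₂ l) * q ^ (e ℕ.+ (1 ℕ.* n₁ ℕ.+ 2 ℕ.* n₂))
        ≈⟨ *-cong (sym (^-assocʳ q 3 (choose₂ l))) (^-homo-* q e _) ⟩
      w l * (q ^ e * q ^ (1 ℕ.* n₁ ℕ.+ 2 ℕ.* n₂))
        ≈⟨ *-congˡ (*-congˡ (^-homo-* q (1 ℕ.* n₁) _)) ⟩
      w l * (q ^ e * (q ^ (1 ℕ.* n₁) * q ^ (2 ℕ.* n₂))) ∎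

  -- The cube of side n + 1 contains the simplex m + n₁ + n₂ ≤ n that supports the summand.
  -- Collapsing (n₁ , n₂) and then joining m follows the bracketing of the product that defines `H`.
  summand-sum : ∀ n → let K = suc n in
    (∑< K) (λ m → (∑< K) λ n₁ → (∑< K) λ n₂ → summand R v (+ n) m n₁ n₂) ≈ S H n
  summand-sum n = begin
    (∑< K) (λ m → (∑< K) λ n₁ → (∑< K) (f m n₁))
      ≈⟨ ∑-cong K (λ m _ → ∑-square K K (f m) ℕₚ.≤-refl λ n₁ n₂ K≤ → f-zero m n₁ n₂
           (ℕₚ.≤-trans K≤ (ℕₚ.m≤n+m (n₁ ℕ.+ n₂) m))) ⟩
    (∑< K) (λ m → (∑< K) (g m))
      ≈⟨ ∑-square K K g ℕₚ.≤-refl (λ m s K≤ → antidiagonal-zero s λ where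
           n₁ n₂ ≡.refl → f-zero m n₁ n₂ K≤) ⟩
    (∑< K) (antidiagonal g)
      ≈⟨ ∑-cong K (λ l l<K → level l (ℕₚ.≤-pred l<K)) ⟩
    (∑< K) (λ l → w l * H (n ∸ l) l)
      ≈⟨ antidiagonal-∑ n (λ l M → w l * H M l) ⟨
    S H n ∎
    where
    K = suc n
    f : ℕ → ℕ → ℕ → Carrier
    f = summand R v (+ n)
    g : ℕ → ℕ → Carrier
    g m = antidiagonal (f m)
    f-zero : ∀ m n₁ n₂ → K ℕ.≤ m ℕ.+ (n₁ ℕ.+ n₂) → f m n₁ n₂ ≈ 0#
    f-zero m n₁ n₂ K≤ = summand-zero (+ n) m n₁ n₂ (+<+ K≤)
    level : ∀ l → l ℕ.≤ n → antidiagonal g l ≈ w l * H (n ∸ l) l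
    level l l≤n = begin
      antidiagonal g l
        ≈⟨ antidiagonal-cong l (λ where
             m s ≡.refl → trans (antidiagonal-cong s λ where
               n₁ n₂ ≡.refl → trans
                 (reflexive (≡.cong (λ n → summand R v (+ n) m n₁ n₂) (≡.sym (ℕₚ.m+[n∸m]≡n l≤n))))
                 (trans (summand-term m n₁ n₂ M) (sym (*-assoc _ _ _)))) (antidiagonal-* s _)) ⟩
      antidiagonal (λ m s → w l * E (M ℕ.* 3) m * (X 1 M ⋆ X 2 M) s) l
        ≈⟨ antidiagonal-cong l (λ _ _ _ → *-assoc _ _ _) ⟩
      antidiagonal (λ m s → w l * (E (M ℕ.* 3) m * (X 1 M ⋆ X 2 M) s)) l
        ≈⟨ antidiagonal-* l (w l) ⟩
      w l * H M l ∎
      where M = n ∸ l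

  ∑-interval : ∀ a b l f → b ℤ.- a ≡ + l → ∑[ a ⋯ b ] f ≈ (∑< suc l) λ i → f (a ℤ.+ + i)
  ∑-interval a b l f eq with b ℤ.- a | eq
  ... | + _ | ≡.refl = refl

  v³ : Variable R
  v³ = v ↑ 3

  -- The factor (Q;Q)_{b+c} cancels between the two q-binomials, leaving the symmetric multinomial
  -- (Q;Q)_n / ((Q;Q)_k (Q;Q)_b (Q;Q)_c), while `pentagonal-difference` separates the power of q.
  trinomial-term : ∀ k b c → let n = k ℕ.+ (b ℕ.+ c) in
    v ^ᶻ pentagonal (+ b ℤ.- + k) *
      (v³ ^ᶻ (+ k ℤ.* + b) * [ + n , + k ] v³ * [ + (b ℕ.+ c) , + b ] v³)
    ≈ ⟨ v³ ⟩ n * B 2 k * (B 1 b * Γ c)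
  trinomial-term k b c with p , pent , p+ ← pentagonal-difference k b = begin
    v ^ᶻ pentagonal (+ b ℤ.- + k) *
      (v³ ^ᶻ (+ k ℤ.* + b) * [ + n , + k ] v³ * [ + (b ℕ.+ c) , + b ] v³)
      ≈⟨ *-cong (reflexive (≡.cong (v ^ᶻ_) pent))
           (*-cong (*-cong (reflexive (≡.cong (v³ ^ᶻ_) (≡.sym (ℤₚ.pos-* k b))))
                           ([]-+ v³ k (b ℕ.+ c)))
                   ([]-+ v³ b c)) ⟩
    q ^ p * (Q ^ (k ℕ.* b) * (⟨ v³ ⟩ n * (Γ k * Γ (b ℕ.+ c))) * (⟨ v³ ⟩ (b ℕ.+ c) * (Γ b * Γ c)))
      ≈⟨ solve 8 (λ x y n k i f b c → x :* (y :* (n :* (k :* i)) :* (f :* (b :* c)))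
                    := (x :* y) :* (f :* i) :* (n :* (k :* (b :* c)))) refl _ _ _ _ _ _ _ _ ⟩
    (q ^ p * Q ^ (k ℕ.* b)) * (⟨ v³ ⟩ (b ℕ.+ c) * Γ (b ℕ.+ c)) * (⟨ v³ ⟩ n * (Γ k * (Γ b * Γ c)))
      ≈⟨ *-congʳ (*-cong powers (⟨⟩-inverseʳ v³ (b ℕ.+ c))) ⟩
    (q ^ penta 2 k * q ^ penta 1 b) * 1# * (⟨ v³ ⟩ n * (Γ k * (Γ b * Γ c)))
      ≈⟨ solve 6 (λ x y n k b c → (x :* y) :* con 1 :* (n :* (k :* (b :* c)))
                    := n :* (x :* k) :* ((y :* b) :* c)) refl _ _ _ _ _ _ ⟩
    ⟨ v³ ⟩ n * B 2 k * (B 1 b * Γ c) ∎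
    where
    n = k ℕ.+ (b ℕ.+ c)
    powers : q ^ p * Q ^ (k ℕ.* b) ≈ q ^ penta 2 k * q ^ penta 1 b
    powers = begin
      q ^ p * Q ^ (k ℕ.* b)              ≈⟨ *-congˡ (^-assocʳ q 3 (k ℕ.* b)) ⟩
      q ^ p * q ^ (3 ℕ.* (k ℕ.* b))      ≈⟨ ^-homo-* q p _ ⟨
      q ^ (p ℕ.+ 3 ℕ.* (k ℕ.* b))        ≈⟨ ^-congʳ q p+ ⟩
      q ^ (penta 2 k ℕ.+ penta 1 b)      ≈⟨ ^-homo-* q (penta 2 k) _ ⟩
      q ^ penta 2 k * q ^ penta 1 b      ∎

  trinomial-row : ∀ k s → let n = k ℕ.+ s in
    (∑< suc (n ℕ.+ n)) (λ i → let j = ℤ.- + n ℤ.+ + i in v ^ᶻ pentagonal j *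
      (v³ ^ᶻ (+ k ℤ.* (+ k ℤ.+ j)) * [ + n , + k ] v³ * [ + n ℤ.- + k , + k ℤ.+ j ] v³))
    ≈ ⟨ v³ ⟩ n * (B 2 k * (B 1 ⋆ Γ) s)
  trinomial-row k s = begin
    (∑< suc (n ℕ.+ n)) f
      -- The index i corresponds to b = k + j = i - s. The 2n + 1 values split into s with b < 0,
      -- then s + 1 with 0 ≤ b ≤ s, then 2k with b > s; only the middle block contributes.
      ≈⟨ reflexive (≡.cong (λ l → (∑< l) f) length) ⟩
    (∑< (s ℕ.+ (suc s ℕ.+ (k ℕ.+ k)))) f
      ≈⟨ ∑-drop s _ below ⟩
    (∑< (suc s ℕ.+ (k ℕ.+ k))) (λ b → f (s ℕ.+ b))
      ≈⟨ ∑-cong (suc s ℕ.+ (k ℕ.+ k)) (λ b _ → shifted b) ⟩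
    (∑< (suc s ℕ.+ (k ℕ.+ k))) g
      ≈⟨ ∑-truncate (suc s) (k ℕ.+ k) above ⟩
    (∑< suc s) g
      ≈⟨ ∑-cong (suc s) (λ b b<s → within b (ℕₚ.≤-pred b<s)) ⟩
    (∑< suc s) (λ b → ⟨ v³ ⟩ n * B 2 k * (B 1 b * Γ (s ∸ b)))
      ≈⟨ antidiagonal-∑ s (λ b c → ⟨ v³ ⟩ n * B 2 k * (B 1 b * Γ c)) ⟨
    antidiagonal (λ b c → ⟨ v³ ⟩ n * B 2 k * (B 1 b * Γ c)) s
      ≈⟨ trans (antidiagonal-* s _) (*-assoc _ _ _) ⟩
    ⟨ v³ ⟩ n * (B 2 k * (B 1 ⋆ Γ) s) ∎
    where
    n = k ℕ.+ s
    t : (j a b : ℤ) → Carrier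
    t j a b = v ^ᶻ pentagonal j * (v³ ^ᶻ (+ k ℤ.* b) * [ + n , + k ] v³ * [ a , b ] v³)
    f g : ℕ → Carrier
    f i = t (ℤ.- + n ℤ.+ + i) (+ n ℤ.- + k) (+ k ℤ.+ (ℤ.- + n ℤ.+ + i))
    g b = t (+ b ℤ.- + k) (+ s) (+ b)

    t-zero : ∀ j a b → [ a , b ] v³ ≈ 0# → t j a b ≈ 0#
    t-zero j a b eq = trans (*-congˡ (trans (*-congˡ eq) (zeroʳ _))) (zeroʳ _)

    length : suc (n ℕ.+ n) ≡ s ℕ.+ (suc s ℕ.+ (k ℕ.+ k))
    length = ℕS.solve 2 (λ k s → con′ 1 ⊕ ((k ⊕ s) ⊕ (k ⊕ s)) ℕS.:= s ⊕ (con′ 1 ⊕ s ⊕ (k ⊕ k))) ≡.refl k s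
      where
      module ℕS = ℕSolver.+-*-Solver
      open ℕS using () renaming (_:+_ to _⊕_; con to con′)

    below : ∀ i → i ℕ.< s → f i ≈ 0#
    below i i<s = t-zero (ℤ.- + n ℤ.+ + i) (+ n ℤ.- + k) _ $ []-neg _ _ v³ $ ≡.subst₂ ℤ._<_
      (ℤS.solve 3 (λ k s i → i ℤS.:- s ℤS.:= k ⊕ (ℤS.:- (k ⊕ s) ⊕ i)) ≡.refl (+ k) (+ s) (+ i))
      (ℤₚ.+-inverseʳ (+ s)) (ℤₚ.+-monoˡ-< (ℤ.- + s) (+<+ i<s))
      where
      module ℤS = ℤSolver.+-*-Solver
      open ℤS using () renaming (_:+_ to _⊕_)

    shifted : ∀ b → f (s ℕ.+ b) ≈ g b
    shifted b = reflexive $ ≡.trans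
      (≡.cong₂ (λ j a → t j a (+ k ℤ.+ (ℤ.- + n ℤ.+ + (s ℕ.+ b))))
        (ℤS.solve 3 (λ k s b → ℤS.:- (k ⊕ s) ⊕ (s ⊕ b) ℤS.:= b ℤS.:- k) ≡.refl (+ k) (+ s) (+ b))
        (+[m+n]-+m≡+n k s))
      (≡.cong (t (+ b ℤ.- + k) (+ s))
        (ℤS.solve 3 (λ k s b → k ⊕ (ℤS.:- (k ⊕ s) ⊕ (s ⊕ b)) ℤS.:= b) ≡.refl (+ k) (+ s) (+ b)))
      where
      module ℤS = ℤSolver.+-*-Solver
      open ℤS using () renaming (_:+_ to _⊕_)

    above : ∀ b → suc s ℕ.≤ b → g b ≈ 0#
    above b s<b = t-zero (+ b ℤ.- + k) (+ s) (+ b) ([]-zero (+ s) (+ b) v³ (+<+ s<b))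

    within : ∀ b → b ℕ.≤ s → g b ≈ ⟨ v³ ⟩ n * B 2 k * (B 1 b * Γ (s ∸ b))
    within b b≤s with c , ≡.refl ← ℕₚ.m≤n⇒∃[o]m+o≡n b≤s = trans (trinomial-term k b c)
      (*-congˡ (*-congˡ (reflexive (≡.cong Γ (≡.sym (ℕₚ.m+n∸m≡n b c))))))

  trinomialSum-T : ∀ n → trinomialSum R v (+ n) ≈ T n
  trinomialSum-T n = begin
    trinomialSum R v (+ n)
      ≈⟨ ∑-interval (ℤ.- + n) (+ n) (n ℕ.+ n) _ (≡.cong (ℤ._+_ (+ n)) (ℤₚ.neg-involutive (+ n))) ⟩
    (∑< suc (n ℕ.+ n)) (λ i → v ^ᶻ pentagonal (j i) * (∑< suc n) (t (j i)))
      ≈⟨ ∑-cong (suc (n ℕ.+ n)) (λ i _ → ∑-*ˡ (suc n) (v ^ᶻ pentagonal (j i)) (t (j i))) ⟩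
    (∑< suc (n ℕ.+ n)) (λ i → (∑< suc n) λ k → v ^ᶻ pentagonal (j i) * t (j i) k)
      -- With k outermost, j can be replaced by b = k + j in each inner sum.
      ≈⟨ ∑-swap (suc (n ℕ.+ n)) (suc n) (λ i k → v ^ᶻ pentagonal (j i) * t (j i) k) ⟩
    (∑< suc n) (λ k → (∑< suc (n ℕ.+ n)) λ i → v ^ᶻ pentagonal (j i) * t (j i) k)
      ≈⟨ ∑-cong (suc n) (λ k k<n → row k (ℕₚ.≤-pred k<n)) ⟩
    (∑< suc n) (λ k → ⟨ v³ ⟩ n * (B 2 k * (B 1 ⋆ Γ) (n ∸ k)))
      ≈⟨ antidiagonal-∑ n (λ k s → ⟨ v³ ⟩ n * (B 2 k * (B 1 ⋆ Γ) s)) ⟨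
    antidiagonal (λ k s → ⟨ v³ ⟩ n * (B 2 k * (B 1 ⋆ Γ) s)) n
      ≈⟨ antidiagonal-* n _ ⟩
    T n ∎
    where
    j : ℕ → ℤ
    j i = ℤ.- + n ℤ.+ + i
    t : ℤ → ℕ → Carrier
    t j k = v³ ^ᶻ (+ k ℤ.* (+ k ℤ.+ j)) * [ + n , + k ] v³ * [ + n ℤ.- + k , + k ℤ.+ j ] v³
    row : ∀ k → k ℕ.≤ n → (∑< suc (n ℕ.+ n)) (λ i → v ^ᶻ pentagonal (j i) * t (j i) k)
                        ≈ ⟨ v³ ⟩ n * (B 2 k * (B 1 ⋆ Γ) (n ∸ k))
    row k k≤n with s , ≡.refl ← ℕₚ.m≤n⇒∃[o]m+o≡n k≤n = trans (trinomial-row k s)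
      (*-congˡ (*-congˡ (reflexive (≡.cong (B 1 ⋆ Γ) (≡.sym (ℕₚ.m+n∸m≡n k s))))))

theorem1p2 : ∀ {c ℓ} (R : CommutativeRing c ℓ) (q : Variable R) (N : ℤ) →
    HasSum₃ R (summand R q N) (trinomialSum R q N)
theorem1p2 R v -[1+ a ] =
  -- For negative N every summand vanishes, so the bound 0 is admissible and both sums are empty.
  0 , (λ m n₁ n₂ _ → summand-zero -[1+ a ] m n₁ n₂ -<+) , CommutativeRing.refl R
  where open Identity R v
theorem1p2 R v (+ n) = suc n , vanishing ,
  trans (summand-sum n) (trans (S≐T n) (sym (trinomialSum-T n)))
  where
  open CommutativeRing R using (_≈_; 0#; trans; sym)
  open Recurrences R v using (S≐T)
  open Identity R v
  vanishing : ∀ m n₁ n₂ → suc n ℕ.≤ m ⊎ suc n ℕ.≤ n₁ ⊎ suc n ℕ.≤ n₂ →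
              summand R v (+ n) m n₁ n₂ ≈ 0#
  vanishing m n₁ n₂ large = summand-zero (+ n) m n₁ n₂ (+<+ (n< large))
    where
    n< : suc n ℕ.≤ m ⊎ suc n ℕ.≤ n₁ ⊎ suc n ℕ.≤ n₂ → suc n ℕ.≤ m ℕ.+ (n₁ ℕ.+ n₂)
    n< (inj₁ n<m)         = ℕₚ.≤-trans n<m (ℕₚ.m≤m+n m _)
    n< (inj₂ (inj₁ n<n₁)) = ℕₚ.≤-trans n<n₁ (ℕₚ.≤-trans (ℕₚ.m≤m+n n₁ n₂) (ℕₚ.m≤n+m _ m))
    n< (inj₂ (inj₂ n<n₂)) = ℕₚ.≤-trans n<n₂ (ℕₚ.≤-trans (ℕₚ.m≤n+m n₂ n₁) (ℕₚ.m≤n+m _ m))
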